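{- Let $1\le m\le n$ and $\pi\in\mathfrak S_{m,n}$. The generic pipe dream polynomial $G^\beta_\pi$ is independent of the hybridization $\beta\in\{\mathsf w,\mathsf e\}^m$.
   Context: Fix $1\le m\le n$. $\mathfrak S_{m,n}$ is the set of injective maps $\{1,\dots,m\}\to\{1,\dots,n\}$. A hybridization is $\beta=(\beta_1,\dots,\beta_m)\in\{\mathsf w,\mathsf e\}^m$; row $i$ (counted from the top) of an $m\times n$ grid is of type $\beta_i$. A hybrid generic pipe dream of type $\beta$ is a filling of the grid (columns $1,\dots,n$ left to right) with tiles, each tile being a unit square in which pipes join midpoints of edges. Allowed tiles in rows of type $\mathsf w$: blank (no pipe); straight tiles: horizontal (West–East), vertical (South–North), cross (both, crossing); elbow tiles: single elbow West–North, single elbow South–East, double elbow (both West–North and South–East). In rows of type $\mathsf e$: blank; the same three straight tiles; elbow tiles: single elbow East–North, single elbow South–West, double elbow (both). Conditions: no pipe starts or ends in the interior of the grid; in each row of type $\mathsf w$ a pipe enters through the West boundary edge and none exits through the East boundary edge; in each row of type $\mathsf e$ a pipe enters through the East boundary edge and none exits through the West; no pipe crosses the South boundary. (Pipes may cross more than once.) Each pipe then exits through the North boundary. Pipes are numbered counterclockwise starting from the northwest corner: the pipes entering from the West are numbered $1,\dots,k$ from top to bottom ($k$ = number of $\mathsf w$ rows), and those entering from the East are numbered $k+1,\dots,m$ from bottom to top; $\varphi(i)$ is the number of the pipe entering in row $i$. The connectivity is the $\pi\in\mathfrak S_{m,n}$ such that pipe numbered $i$ exits the North side in column $\pi(i)$.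 The weight of a pipe dream is the product over its tiles, in $\mathbb Z[x_1,\dots,x_m,y_1,\dots,y_n,A,B]$, of: $A+B$ for elbow tiles; if $\beta_i=\mathsf w$, $B-x_{\varphi(i)}+y_j$ for a blank tile and $A+x_{\varphi(i)}-y_j$ for a straight tile at $(i,j)$; if $\beta_i=\mathsf e$, $A+x_{\varphi(i)}-y_j$ for a blank tile and $B-x_{\varphi(i)}+y_j$ for a straight tile at $(i,j)$. $G^\beta_\pi$ is the sum of the weights of all hybrid generic pipe dreams of type $\beta$ with connectivity $\pi$. -}

module Defs where

open import Level using (Level)
open import Data.Bool using (Bool; true; false; _∧_; _∨_; not; if_then_else_)
open import Data.Nat using (ℕ; zero; suc; _∸_; _≡ᵇ_)
import Data.Nat as Nat
open import Data.Fin using (Fin; toℕ)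
open import Data.List using (List; []; _∷_; map; foldr; concatMap; filterᵇ; upTo; length)
open import Data.Vec using (Vec; toList)
open import Data.Maybe using (Maybe; just; nothing; is-just)
open import Data.Product using (_×_; _,_)
open import Algebra.Bundles using (CommutativeRing)

-- Conventions: all indices are 0-based.
--   rows i ∈ {0,…,m-1} (top to bottom), columns j ∈ {0,…,n-1} (left to right),
--   pipe numbers k ∈ {0,…,m-1}; pipe k of this file is pipe k+1 of the paper,
--   so the variable x_{k+1} (resp. y_{j+1}) of the paper is  x k  (resp. y j).

data HT : Set where
  w e : HT

_==ʰ_ : HT → HT → Bool
w ==ʰ w = true
e ==ʰ e = true
_ ==ʰ _ = false

-- tiles.  The meaning of the elbow tiles depends on the row type:
--   elbowUp   : West–North (row type w)  /  East–North (row type e)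
--   elbowDown : South–East (row type w)  /  South–West (row type e)
--   double    : both elbows of the row type
data Tile : Set where
  blank hor ver cross elbowUp elbowDown double : Tile

allTiles : List Tile
allTiles = blank ∷ hor ∷ ver ∷ cross ∷ elbowUp ∷ elbowDown ∷ double ∷ []

data Side : Set where
  N S E W : Side

opp : Side → Side
opp N = S
opp S = N
opp E = W
opp W = E

connect : HT → Tile → Side → Maybe Side
connect h blank s = nothing
connect h hor W = just E
connect h hor E = just W
connect h hor _ = nothing
connect h ver S = just N
connect h ver N = just S
connect h ver _ = nothing
connect h cross W = just E
connect h cross E = just W
connect h cross S = just N
connect h cross N = just S
connect w elbowUp W = just N
connect w elbowUp N = just W
connect w elbowUp _ = nothing
connect w elbowDown S = just E
connect w elbowDown E = just S
connect w elbowDown _ = nothing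
connect w double W = just N
connect w double N = just W
connect w double S = just E
connect w double E = just S
connect e elbowUp E = just N
connect e elbowUp N = just E
connect e elbowUp _ = nothing
connect e elbowDown S = just W
connect e elbowDown W = just S
connect e elbowDown _ = nothing
connect e double E = just N
connect e double N = just E
connect e double S = just W
connect e double W = just S

uses : HT → Tile → Side → Bool
uses h t s = is-just (connect h t s)

isElbow : Tile → Bool
isElbow elbowUp = true
isElbow elbowDown = true
isElbow double = true
isElbow _ = false

isStraight : Tile → Bool
isStraight hor = true
isStraight ver = true
isStraight cross = true
isStraight _ = false

at : {A : Set} → List A → ℕ → Maybe A
at [] _ = nothing
at (a ∷ as) zero = just a
at (a ∷ as) (suc k) = at as k

allLists : {A : Set} → ℕ → List A → List (List A)
allLists zero xs = [] ∷ []
allLists (suc k) xs = concatMap (λ a → map (a ∷_) (allLists k xs)) xs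

anyᵇ : {A : Set} → (A → Bool) → List A → Bool
anyᵇ p [] = false
anyᵇ p (a ∷ as) = p a ∨ anyᵇ p as

allᵇ : {A : Set} → (A → Bool) → List A → Bool
allᵇ p [] = true
allᵇ p (a ∷ as) = p a ∧ allᵇ p as

count : {A : Set} → (A → Bool) → List A → ℕ
count p [] = 0
count p (a ∷ as) = (if p a then 1 else 0) Nat.+ count p as

drop' : {A : Set} → ℕ → List A → List A
drop' zero xs = xs
drop' (suc k) [] = []
drop' (suc k) (x ∷ xs) = drop' k xs

take' : {A : Set} → ℕ → List A → List A
take' zero xs = []
take' (suc k) [] = []
take' (suc k) (x ∷ xs) = x ∷ take' k xs

Grid : Set
Grid = List (List Tile)

allGrids : ℕ → ℕ → List Grid
allGrids m n = allLists m (allLists n allTiles)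

cell : Grid → ℕ → ℕ → Maybe Tile
cell g i j with at g i
... | nothing = nothing
... | just r = at r j

rowType : List HT → ℕ → HT
rowType β i with at β i
... | just h = h
... | nothing = w   -- never used: only rows 0,…,m-1 are queried

step : Side → ℕ × ℕ → Maybe (ℕ × ℕ)
step N (zero , j) = nothing
step N (suc i , j) = just (i , j)
step S (i , j) = just (suc i , j)
step W (i , zero) = nothing
step W (i , suc j) = just (i , j)
step E (i , j) = just (i , suc j)

inGrid : Grid → Maybe (ℕ × ℕ) → Maybe Tile
inGrid g nothing = nothing
inGrid g (just (i , j)) = cell g i j

_==ᵇ_ : Bool → Bool → Bool
true ==ᵇ b = b
false ==ᵇ b = not b

allSides : List Side
allSides = N ∷ S ∷ E ∷ W ∷ []

-- local condition at side s of cell (i , j) holding tile t: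
--  * interior edge: pipe ends on both sides of the edge or on neither
--    (no pipe starts or ends in the interior);
--  * North boundary: no condition;
--  * South boundary: no pipe;
--  * West boundary: a pipe iff the row is of type w;
--  * East boundary: a pipe iff the row is of type e.
sideOK : List HT → Grid → ℕ → ℕ → Tile → Side → Bool
sideOK β g i j t s = check (step s (i , j))
  where
    here : Bool
    here = uses (rowType β i) t s
    boundary : Side → Bool
    boundary N = true
    boundary S = not here
    boundary W = here ==ᵇ (rowType β i ==ʰ w)
    boundary E = here ==ᵇ (rowType β i ==ʰ e)
    check : Maybe (ℕ × ℕ) → Bool
    check nothing = boundary s
    check (just (i' , j')) with cell g i' j'
    ... | nothing = boundary s
    ... | just t' = here ==ᵇ uses (rowType β i') t' (opp s)

validPD : ℕ → ℕ → List HT → Grid → Bool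
validPD m n β g =
  allᵇ (λ i → allᵇ (λ j → cellOK i j (cell g i j)) (upTo n)) (upTo m)
  where
    cellOK : ℕ → ℕ → Maybe Tile → Bool
    cellOK i j nothing = false
    cellOK i j (just t) = allᵇ (sideOK β g i j t) allSides

-- following a pipe: currently in cell (i , j), having entered through side s.
-- Returns the column through which it exits the North boundary (nothing if it
-- leaves otherwise, or the fuel runs out).
follow : ℕ → List HT → Grid → ℕ → ℕ → Side → Maybe ℕ
follow zero β g i j s = nothing
follow (suc fuel) β g i j s with cell g i j
... | nothing = nothing
... | just t with connect (rowType β i) t s
...   | nothing = nothing
...   | just s' = leave s' (step s' (i , j))
  where
    leave : Side → Maybe (ℕ × ℕ) → Maybe ℕ
    leave N nothing = just j          -- i = 0: exits the North boundary in column j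
    leave _ nothing = nothing
    leave s' (just (i' , j')) with cell g i' j'
    ... | just _ = follow fuel β g i' j' (opp s')
    ... | nothing = nothing           -- leaves through the South/East boundary

exitOf : ℕ → ℕ → List HT → Grid → ℕ → Maybe ℕ
exitOf m n β g i with rowType β i
... | w = follow (4 Nat.* (m Nat.* n) Nat.+ 4) β g i 0 W
... | e = follow (4 Nat.* (m Nat.* n) Nat.+ 4) β g i (n ∸ 1) E

-- φ(i) (0-based): pipes entering from the West are numbered 0,…,k-1 from top
-- to bottom, those entering from the East k,…,m-1 from bottom to top.
φ : List HT → ℕ → ℕ
φ β i with rowType β i
... | w = count (_==ʰ w) (take' i β)
... | e = count (_==ʰ w) β Nat.+ count (_==ʰ e) (drop' (suc i) β)

_==ᵐ_ : Maybe ℕ → ℕ → Bool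
nothing ==ᵐ _ = false
just a ==ᵐ b = a ≡ᵇ b

hasConnectivity : (m n : ℕ) → List HT → (Fin m → Fin n) → Grid → Bool
hasConnectivity m n β π g =
  allᵇ (λ i → anyᵇ (λ k → (φ β i ≡ᵇ toℕ k) ∧ (exitOf m n β g i ==ᵐ toℕ (π k)))
                  (Data.List.allFin m))
       (upTo m)

-- weights and the polynomial G^β_π, evaluated in a commutative ring R at
-- x : ℕ → R, y : ℕ → R, A B : R.

module _ {c ℓ : Level} (R : CommutativeRing c ℓ) where
  open CommutativeRing R

  tileWeight : (x y : ℕ → Carrier) (A B : Carrier) → HT → ℕ → ℕ → Tile → Carrier
  tileWeight x y A B h p j t =
    if isElbow t then A + B
    else if isStraight t then straight h
    else blankW h
    where
      straight : HT → Carrier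
      straight w = A + x p - y j
      straight e = B - x p + y j
      blankW : HT → Carrier
      blankW w = B - x p + y j
      blankW e = A + x p - y j

  weight : (x y : ℕ → Carrier) (A B : Carrier) → List HT → Grid → Carrier
  weight x y A B β g =
    foldr _*_ 1# (map (λ i → foldr _*_ 1# (map (λ j → tw i j (cell g i j))
                                                 (upTo (rowLen i))))
                      (upTo (length g)))
    where
      rowLen : ℕ → ℕ
      rowLen i with at g i
      ... | nothing = 0
      ... | just r = length r
      tw : ℕ → ℕ → Maybe Tile → Carrier
      tw i j nothing = 1#
      tw i j (just t) = tileWeight x y A B (rowType β i) (φ β i) j t

  G : (m n : ℕ) → Vec HT m → (Fin m → Fin n) → (x y : ℕ → Carrier) (A B : Carrier) → Carrier
  G m n β π x y A B =
    foldr _+_ 0#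
      (map (weight x y A B (toList β))
        (filterᵇ (λ g → validPD m n (toList β) g ∧ hasConnectivity m n (toList β) π g)
                 (allGrids m n)))

{-# OPTIONS --safe #-}

-- Colour every edge by the number of the pipe through it, or by a blank colour.  A row then becomes an
-- operator from the colours of its South edges to those of its North edges, and G is an entry of the
-- product of these operators.  A blank tile weighs an elbow minus a straight tile; so at every cell one
-- sums over straight and elbow, straight having the sign -1 if both incoming colours are blank: this
-- is the gl(m|1) vertex model.
--
-- Two moves connect all hybridizations, and both preserve the numbering of the pipes: changing the type
-- of the bottom row, where the two types agree tile by tile, and exchanging adjacent rows of types w and
-- e.  The second is a Yang–Baxter argument.  Cut the two rows at a column and let U p r and V p r be the
-- sums over the part to the right of the cut, with the e row at the bottom resp. at the top, when the w
-- row enters with colour p and the e row exits with colour r.  The Yang–Baxter equation would give U = V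
-- only after cancelling A + B + x_a - x_b, which is not allowed in an arbitrary ring.  Instead, one shows
-- column by column that for a single scalar q
--   V p r = ±U p r + (A + B) [p = r] q   and   ∑_p U p p = (A + B + x_a - x_b) q,
-- which yields V = U at the boundary colours of the rows, because p is a pipe and r is blank.
module Submission where

open import Defs
open import Level using (Level)
open import Data.Bool using (Bool; true; false; _∧_; if_then_else_; not)
open import Data.Nat as ℕ using (ℕ; zero; suc; _≤_; _<_; _≡ᵇ_; z≤n; s≤s)
import Data.Nat.Properties as ℕₚ
open import Data.Fin using (Fin; zero; suc; fromℕ; fromℕ<; inject₁; toℕ)
import Data.Fin.Properties as Finₚ
open import Data.Fin.Properties using (_≟_)
open import Data.Fin.Relation.Unary.Top using (view; ‵fromℕ; ‵inject₁)
open import Data.List using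
  (List; []; _∷_; _++_; map; foldr; concatMap; filterᵇ; allFin; tabulate; applyUpTo; upTo; length)
open import Data.Maybe using (Maybe; just; nothing)
open import Data.Vec as Vec using (Vec; []; _∷_)
import Data.Vec.Properties as Vecₚ
open import Data.Product using (_×_; _,_; proj₁; proj₂; ∃-syntax; Σ-syntax)
open import Data.Sum using (_⊎_; inj₁; inj₂)
open import Function using (_∘_; id)
open import Function.Definitions using (Injective)
open import Relation.Nullary using (yes; no; ¬_; contradiction; does)
open import Relation.Nullary.Decidable using (dec-true)
open import Relation.Binary.PropositionalEquality as ≡ using (_≡_; _≢_; cong)
open import Algebra.Bundles using (CommutativeRing)
import Algebra.Solver.Ring.NaturalCoefficients.Default as NatSolver

-- Write `z` for A + B + x_a - x_b. Multiplying the first of the two equations by `z` and inserting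
-- the second gives z V p r = ±z U p r + (A + B) [p = r] ∑ U a a, a relation of Yang-Baxter type. So
-- `q` is the quotient of the trace ∑ U a a by `z`, and the point is to exhibit this quotient
-- instead of dividing: it satisfies a recursion on the columns in which V supplies the new term.
-- The trace is unavoidable. With the `e` row at the bottom, elbows in both rows of one column turn
-- the colour arriving along the `e` row upwards and back to the East, where it came from, so it is
-- summed over. This sum is z q, while the mixed straight-elbow terms leave u q + v q. They agree
-- because u + v = z in every column, the y_j cancelling. What remains is to compare two
-- descriptions. `G` tests edges cell by cell and follows pipes with bounded fuel; the operators
-- propagate colours from the blank South boundary. A tile determines its outgoing colours from the
-- incoming ones, so the tiles fix all colours, and conservation of colours makes the top column of
-- each pipe unique.

-- Colour zero is blank, suc k is pipe k.
Colour : ℕ → Set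
Colour K = Fin (suc K)

vecs : {X : Set} → List X → (n : ℕ) → List (Vec X n)
vecs xs zero    = [] ∷ []
vecs xs (suc n) = concatMap (λ a → map (a ∷_) (vecs xs n)) xs

-- Finite sums and products in a ring

module FiniteSums {c ℓ : Level} (R : CommutativeRing c ℓ) where
  open CommutativeRing R hiding (zero)
  open import Relation.Binary.Reasoning.Setoid setoid
  open NatSolver commutativeSemiring using (solve; _:=_; _:+_; _:*_; con)

  ∑ : {X : Set} → List X → (X → Carrier) → Carrier
  ∑ []       f = 0#
  ∑ (a ∷ xs) f = f a + ∑ xs f

  foldr-map≡∑ : {X : Set} (xs : List X) (f : X → Carrier) → foldr _+_ 0# (map f xs) ≡ ∑ xs f
  foldr-map≡∑ []       f = ≡.refl
  foldr-map≡∑ (a ∷ xs) f = cong (f a +_) (foldr-map≡∑ xs f)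

  ∏ : ∀ {n} → (Fin n → Carrier) → Carrier
  ∏ {zero}  f = 1#
  ∏ {suc n} f = f zero * ∏ (f ∘ suc)

  ∏-cong : ∀ {n} {f g : Fin n → Carrier} → (∀ i → f i ≈ g i) → ∏ f ≈ ∏ g
  ∏-cong {zero}  f≈g = refl
  ∏-cong {suc n} f≈g = *-cong (f≈g zero) (∏-cong (f≈g ∘ suc))

  ∏-applyUpTo : ∀ {X : Set} n (g : ℕ → X) (f : X → Carrier) →
    foldr _*_ 1# (map f (applyUpTo g n)) ≡ ∏ {n} (λ i → f (g (toℕ i)))
  ∏-applyUpTo zero    g f = ≡.refl
  ∏-applyUpTo (suc n) g f = cong (f (g 0) *_) (∏-applyUpTo n (g ∘ suc) f)

  ι : Bool → Carrier
  ι p = if p then 1# else 0#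

  ι-∧ : ∀ p q → ι (p ∧ q) ≈ ι p * ι q
  ι-∧ true  q = sym (*-identityˡ _)
  ι-∧ false q = sym (zeroˡ _)

  module _ {X : Set} where

    ∑-cong : ∀ (xs : List X) {f g} → (∀ a → f a ≈ g a) → ∑ xs f ≈ ∑ xs g
    ∑-cong []       f≈g = refl
    ∑-cong (a ∷ xs) f≈g = +-cong (f≈g a) (∑-cong xs f≈g)

    ∑-zero : ∀ (xs : List X) {f} → (∀ a → f a ≈ 0#) → ∑ xs f ≈ 0#
    ∑-zero []       f≈0 = refl
    ∑-zero (a ∷ xs) f≈0 = trans (+-cong (f≈0 a) (∑-zero xs f≈0)) (+-identityˡ _)

    ∑-+ : ∀ (xs : List X) f g → ∑ xs (λ a → f a + g a) ≈ ∑ xs f + ∑ xs g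
    ∑-+ []       f g = sym (+-identityˡ _)
    ∑-+ (a ∷ xs) f g = trans (+-congˡ (∑-+ xs f g))
      (solve 4 (λ p q r s → (p :+ q) :+ (r :+ s) := (p :+ r) :+ (q :+ s)) refl _ _ _ _)

    *-∑ : ∀ (xs : List X) k f → k * ∑ xs f ≈ ∑ xs (λ a → k * f a)
    *-∑ []       k f = zeroʳ k
    *-∑ (a ∷ xs) k f = trans (distribˡ k _ _) (+-congˡ (*-∑ xs k f))

    ∑-* : ∀ (xs : List X) f k → ∑ xs f * k ≈ ∑ xs (λ a → f a * k)
    ∑-* []       f k = zeroˡ k
    ∑-* (a ∷ xs) f k = trans (distribʳ k _ _) (+-congˡ (∑-* xs f k))

    ∑-++ : ∀ (xs ys : List X) f → ∑ (xs ++ ys) f ≈ ∑ xs f + ∑ ys f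
    ∑-++ []       ys f = sym (+-identityˡ _)
    ∑-++ (a ∷ xs) ys f = trans (+-congˡ (∑-++ xs ys f)) (sym (+-assoc _ _ _))

    ∑-filter : ∀ (p : X → Bool) xs f → ∑ (filterᵇ p xs) f ≈ ∑ xs (λ a → ι (p a) * f a)
    ∑-filter p []       f = refl
    ∑-filter p (a ∷ xs) f with p a
    ... | true  = +-cong (sym (*-identityˡ _)) (∑-filter p xs f)
    ... | false = trans (∑-filter p xs f) (sym (trans (+-congʳ (zeroˡ _)) (+-identityˡ _)))

  ∑-map : {X Y : Set} (g : X → Y) (xs : List X) (f : Y → Carrier) → ∑ (map g xs) f ≈ ∑ xs (f ∘ g)
  ∑-map g []       f = refl
  ∑-map g (a ∷ xs) f = +-congˡ (∑-map g xs f)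

  ∑-concatMap : {X Y : Set} (g : X → List Y) (xs : List X) (f : Y → Carrier) →
    ∑ (concatMap g xs) f ≈ ∑ xs (λ a → ∑ (g a) f)
  ∑-concatMap g []       f = refl
  ∑-concatMap g (a ∷ xs) f = trans (∑-++ (g a) _ f) (+-congˡ (∑-concatMap g xs f))

  ∑-swap : {X Y : Set} (xs : List X) (ys : List Y) (f : X → Y → Carrier) →
    ∑ xs (λ a → ∑ ys (f a)) ≈ ∑ ys (λ b → ∑ xs (λ a → f a b))
  ∑-swap []       ys f = sym (∑-zero ys (λ _ → refl))
  ∑-swap (a ∷ xs) ys f = trans (+-congˡ (∑-swap xs ys f)) (sym (∑-+ ys _ _))

  ∑-vecs : {X : Set} (xs : List X) (n : ℕ) (f : Vec X (suc n) → Carrier) →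
    ∑ (vecs xs (suc n)) f ≈ ∑ xs (λ a → ∑ (vecs xs n) (λ v → f (a ∷ v)))
  ∑-vecs xs n f = trans (∑-concatMap _ xs f) (∑-cong xs (λ a → ∑-map (a ∷_) (vecs xs n) f))

  ∑-allLists : {X : Set} (xs : List X) (k : ℕ) (f : List X → Carrier) →
    ∑ (allLists k xs) f ≈ ∑ (vecs xs k) (f ∘ Vec.toList)
  ∑-allLists xs zero    f = refl
  ∑-allLists xs (suc k) f = begin
    ∑ (allLists (suc k) xs) f
      ≈⟨ ∑-concatMap _ xs f ⟩
    ∑ xs (λ a → ∑ (map (a ∷_) (allLists k xs)) f)
      ≈⟨ ∑-cong xs (λ a → trans (∑-map (a ∷_) (allLists k xs) f) (∑-allLists xs k _)) ⟩
    ∑ xs (λ a → ∑ (vecs xs k) (λ v → f (a ∷ Vec.toList v)))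
      ≈⟨ ∑-vecs xs k (f ∘ Vec.toList) ⟨
    ∑ (vecs xs (suc k)) (f ∘ Vec.toList) ∎

  ∑-vecs-reindex : {X Y : Set} (xs : List X) (ys : List Y) (g : Y → X) →
    (∀ f → ∑ xs f ≈ ∑ ys (f ∘ g)) →
    ∀ k f → ∑ (vecs xs k) f ≈ ∑ (vecs ys k) (f ∘ Vec.map g)
  ∑-vecs-reindex xs ys g eq zero    f = refl
  ∑-vecs-reindex xs ys g eq (suc k) f = begin
    ∑ (vecs xs (suc k)) f
      ≈⟨ ∑-vecs xs k f ⟩
    ∑ xs (λ a → ∑ (vecs xs k) (λ v → f (a ∷ v)))
      ≈⟨ eq _ ⟩
    ∑ ys (λ b → ∑ (vecs xs k) (λ v → f (g b ∷ v)))
      ≈⟨ ∑-cong ys (λ b → ∑-vecs-reindex xs ys g eq k _) ⟩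
    ∑ ys (λ b → ∑ (vecs ys k) (λ v → f (g b ∷ Vec.map g v)))
      ≈⟨ ∑-vecs ys k (f ∘ Vec.map g) ⟨
    ∑ (vecs ys (suc k)) (f ∘ Vec.map g) ∎

  δ : ∀ {K} → Fin K → Fin K → Carrier
  δ a b = ι (does (a ≟ b))

  δ-sym : ∀ {K} (a b : Fin K) → δ a b ≈ δ b a
  δ-sym a b with a ≟ b | b ≟ a
  ... | yes _ | yes _ = refl
  ... | no  _ | no  _ = refl
  ... | yes p | no ¬q = contradiction (≡.sym p) ¬q
  ... | no ¬p | yes q = contradiction (≡.sym q) ¬p

  δ-refl : ∀ {K} (a : Fin K) → δ a a ≈ 1#
  δ-refl a with a ≟ a
  ... | yes _ = refl
  ... | no ¬p = contradiction ≡.refl ¬p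

  δ-≢ : ∀ {K} {a b : Fin K} → a ≢ b → δ a b ≈ 0#
  δ-≢ {a = a} {b} a≢b with a ≟ b
  ... | yes p = contradiction p a≢b
  ... | no  _ = refl

  δ-subst : ∀ {K} (f : Fin K → Carrier) a b → δ a b * f a ≈ δ a b * f b
  δ-subst f a b with a ≟ b
  ... | yes ≡.refl = refl
  ... | no  _      = trans (zeroˡ _) (sym (zeroˡ _))

  δ-suc : ∀ {K} (a b : Fin K) → δ (suc a) (suc b) ≈ δ a b
  δ-suc a b with a ≟ b | suc a ≟ suc b
  ... | yes _      | yes _      = refl
  ... | no  _      | no  _      = refl
  ... | yes ≡.refl | no ¬q      = contradiction ≡.refl ¬q
  ... | no ¬p      | yes ≡.refl = contradiction ≡.refl ¬p

  ∑-tabulate : ∀ {X : Set} {K} (g : Fin K → X) (f : X → Carrier) →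
    ∑ (tabulate g) f ≈ ∑ (allFin K) (f ∘ g)
  ∑-tabulate {K = zero}  g f = refl
  ∑-tabulate {K = suc K} g f = +-congˡ (trans (∑-tabulate (g ∘ suc) f) (sym (∑-tabulate suc (f ∘ g))))

  ∑-allFin : ∀ {K} (f : Fin (suc K) → Carrier) → ∑ (allFin (suc K)) f ≈ f zero + ∑ (allFin K) (f ∘ suc)
  ∑-allFin {K} f = +-congˡ (∑-tabulate {X = Fin (suc K)} suc f)

  ∑-δ : ∀ {K} (s : Fin K) (f : Fin K → Carrier) → ∑ (allFin K) (λ a → δ a s * f a) ≈ f s
  ∑-δ {suc K} zero f = begin
    ∑ (allFin (suc K)) (λ a → δ a zero * f a)
      ≈⟨ ∑-allFin (λ a → δ a zero * f a) ⟩
    1# * f zero + ∑ (allFin K) (λ a → 0# * f (suc a))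
      ≈⟨ +-cong (*-identityˡ _) (∑-zero (allFin K) (λ a → zeroˡ _)) ⟩
    f zero + 0#
      ≈⟨ +-identityʳ _ ⟩
    f zero ∎
  ∑-δ {suc K} (suc s) f = begin
    ∑ (allFin (suc K)) (λ a → δ a (suc s) * f a)
      ≈⟨ ∑-allFin (λ a → δ a (suc s) * f a) ⟩
    0# * f zero + ∑ (allFin K) (λ a → δ (suc a) (suc s) * f (suc a))
      ≈⟨ +-cong (zeroˡ _) (∑-cong (allFin K) (λ a → *-congʳ (δ-suc a s))) ⟩
    0# + ∑ (allFin K) (λ a → δ a s * f (suc a))
      ≈⟨ trans (+-identityˡ _) (∑-δ s (f ∘ suc)) ⟩
    f (suc s) ∎

  δᵛ : ∀ {K n} → Vec (Fin K) n → Vec (Fin K) n → Carrier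
  δᵛ []      []      = 1#
  δᵛ (a ∷ v) (b ∷ u) = δ a b * δᵛ v u

  ∑-δᵛ : ∀ {K n} (u : Vec (Fin K) n) (f : Vec (Fin K) n → Carrier) →
    ∑ (vecs (allFin K) n) (λ v → δᵛ v u * f v) ≈ f u
  ∑-δᵛ []      f = trans (+-identityʳ _) (*-identityˡ _)
  ∑-δᵛ {K} {suc n} (b ∷ u) f = begin
    ∑ (vecs (allFin K) (suc n)) (λ v → δᵛ v (b ∷ u) * f v)
      ≈⟨ ∑-vecs (allFin K) n _ ⟩
    ∑ (allFin K) (λ a → ∑ (vecs (allFin K) n) (λ v → (δ a b * δᵛ v u) * f (a ∷ v)))
      ≈⟨ ∑-cong (allFin K) (λ a → trans (∑-cong (vecs (allFin K) n) (λ v → *-assoc _ _ _))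
                                   (trans (sym (*-∑ (vecs (allFin K) n) (δ a b) _))
                                          (*-congˡ (∑-δᵛ u (λ v → f (a ∷ v)))))) ⟩
    ∑ (allFin K) (λ a → δ a b * f (a ∷ u))
      ≈⟨ ∑-δ b (λ a → f (a ∷ u)) ⟩
    f (b ∷ u) ∎

  δᵛ-sym : ∀ {K n} (v u : Vec (Fin K) n) → δᵛ v u ≈ δᵛ u v
  δᵛ-sym []      []      = refl
  δᵛ-sym (a ∷ v) (b ∷ u) = *-cong (δ-sym a b) (δᵛ-sym v u)

-- Colouring the edges of a grid

-- p is the colour entering the tile along the row, s the one entering from the South.
through north : {X : Set} → Tile → X → X → X
through t p s = if isElbow t then s else p
north   t p s = if isElbow t then p else s

isPipe : ∀ {K} → Colour K → Bool
isPipe zero    = false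
isPipe (suc _) = true

-- One test serves both row types: tiles of the same name are mirror images, so `hor`, `elbowUp` and
-- the others use East in an `e` row exactly when they use West in a `w` row, and South alike.
fits : ∀ {K} → Tile → Colour K → Colour K → Bool
fits t p s = (uses w t W ==ᵇ isPipe p) ∧ (uses w t S ==ᵇ isPipe s)

module _ {K : ℕ} where

  -- A row of type e is read from right to left, so its colours are computed from the tail of the list.
  exitᵉ : ∀ {n} → Colour K → Vec Tile n → Vec (Colour K) n → Colour K
  exitᵉ k []       []       = k
  exitᵉ k (t ∷ ts) (s ∷ ss) = through t (exitᵉ k ts ss) s

  northsʷ northsᵉ : ∀ {n} → Colour K → Vec Tile n → Vec (Colour K) n → Vec (Colour K) n
  northsʷ p []       []       = []
  northsʷ p (t ∷ ts) (s ∷ ss) = north t p s ∷ northsʷ (through t p s) ts ss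
  northsᵉ k []       []       = []
  northsᵉ k (t ∷ ts) (s ∷ ss) = north t (exitᵉ k ts ss) s ∷ northsᵉ k ts ss

  -- The recursion on a `w` row ends at its East exit, which can be tested there. The West exit of
  -- an `e` row is known only at the head of the list, so `rowValid` tests it separately.
  validʷ fitsᵉ : ∀ {n} → Colour K → Vec Tile n → Vec (Colour K) n → Bool
  validʷ p []       []       = not (isPipe p)
  validʷ p (t ∷ ts) (s ∷ ss) = fits t p s ∧ validʷ (through t p s) ts ss
  fitsᵉ k []       []       = true
  fitsᵉ k (t ∷ ts) (s ∷ ss) = fits t (exitᵉ k ts ss) s ∧ fitsᵉ k ts ss

  rowNorths : ∀ {n} → HT → Fin K → Vec Tile n → Vec (Colour K) n → Vec (Colour K) n
  rowNorths w k = northsʷ (suc k)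
  rowNorths e k = northsᵉ (suc k)

  rowValid : ∀ {n} → HT → Fin K → Vec Tile n → Vec (Colour K) n → Bool
  rowValid w k ts ss = validʷ (suc k) ts ss
  rowValid e k ts ss = fitsᵉ (suc k) ts ss ∧ not (isPipe (exitᵉ (suc k) ts ss))

  norths : ∀ {m n} → Vec HT m → Vec (Fin K) m → Vec (Vec Tile n) m → Vec (Colour K) n
  norths []      []       []       = Vec.replicate _ zero
  norths (h ∷ β) (k ∷ ks) (ts ∷ g) = rowNorths h k ts (norths β ks g)

  valid : ∀ {m n} → Vec HT m → Vec (Fin K) m → Vec (Vec Tile n) m → Bool
  valid []      []       []       = true
  valid (h ∷ β) (k ∷ ks) (ts ∷ g) = rowValid h k ts (norths β ks g) ∧ valid β ks g

-- φ without arithmetic: a w row takes the least of the remaining numbers, an e row the greatest.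
labels : ∀ {K m} → Vec HT m → (Fin m → Fin K) → Vec (Fin K) m
labels []      f = []
labels (w ∷ β) f = f zero ∷ labels β (f ∘ suc)
labels (e ∷ β) f = f (fromℕ _) ∷ labels β (f ∘ inject₁)

-- Lookups in grids and the numbering of the pipes

at-toList : ∀ {X : Set} {n} (v : Vec X n) i → at (Vec.toList v) (toℕ i) ≡ just (Vec.lookup v i)
at-toList (a ∷ v) zero    = ≡.refl
at-toList (a ∷ v) (suc i) = at-toList v i

rows : ∀ {m n} → Vec (Vec Tile n) m → Grid
rows g = Vec.toList (Vec.map Vec.toList g)

at-rows : ∀ {m n} (g : Vec (Vec Tile n) m) i → at (rows g) (toℕ i) ≡ just (Vec.toList (Vec.lookup g i))
at-rows (ts ∷ g) zero    = ≡.refl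
at-rows (ts ∷ g) (suc i) = at-rows g i

rowType-toList : ∀ {m} (β : Vec HT m) i → rowType (Vec.toList β) (toℕ i) ≡ Vec.lookup β i
rowType-toList β i rewrite at-toList β i = ≡.refl

φ-w-suc : ∀ β i → φ (w ∷ β) (suc i) ≡ suc (φ β i)
φ-w-suc β i with at β i
... | just w  = ≡.refl
... | just e  = ≡.refl
... | nothing = ≡.refl

φ-e-suc : ∀ β i → φ (e ∷ β) (suc i) ≡ φ β i
φ-e-suc β i with at β i
... | just w  = ≡.refl
... | just e  = ≡.refl
... | nothing = ≡.refl

count-w+e : ∀ {m} (β : Vec HT m) → count (_==ʰ w) (Vec.toList β) ℕ.+ count (_==ʰ e) (Vec.toList β) ≡ m
count-w+e []      = ≡.refl
count-w+e (w ∷ β) = cong suc (count-w+e β)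
count-w+e (e ∷ β) = ≡.trans (ℕₚ.+-suc _ _) (cong suc (count-w+e β))

label : ∀ {m} → Vec HT m → Fin m → Fin m
label (w ∷ β) zero    = zero
label (w ∷ β) (suc i) = suc (label β i)
label (e ∷ β) zero    = fromℕ _
label (e ∷ β) (suc i) = inject₁ (label β i)

φ-label : ∀ {m} (β : Vec HT m) i → φ (Vec.toList β) (toℕ i) ≡ toℕ (label β i)
φ-label (w ∷ β) zero    = ≡.refl
φ-label (w ∷ β) (suc i) = ≡.trans (φ-w-suc (Vec.toList β) (toℕ i)) (cong suc (φ-label β i))
-- A top `e` row gets the number of all `w` rows plus that of the `e` rows below it, which is the
-- number of all rows below: the last index.
φ-label (e ∷ β) zero    = ≡.trans (count-w+e β) (≡.sym (Finₚ.toℕ-fromℕ _))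
φ-label (e ∷ β) (suc i) = ≡.trans (φ-e-suc (Vec.toList β) (toℕ i)) (≡.trans (φ-label β i) (≡.sym (Finₚ.toℕ-inject₁ _)))

lookup-labels : ∀ {K m} (β : Vec HT m) (f : Fin m → Fin K) i → Vec.lookup (labels β f) i ≡ f (label β i)
lookup-labels (w ∷ β) f zero    = ≡.refl
lookup-labels (w ∷ β) f (suc i) = lookup-labels β (f ∘ suc) i
lookup-labels (e ∷ β) f zero    = ≡.refl
lookup-labels (e ∷ β) f (suc i) = lookup-labels β (f ∘ inject₁) i

label-injective : ∀ {m} (β : Vec HT m) {i j} → label β i ≡ label β j → i ≡ j
label-injective (w ∷ β) {zero}  {zero}  eq = ≡.refl
label-injective (w ∷ β) {suc i} {suc j} eq = cong suc (label-injective β (Finₚ.suc-injective eq))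
label-injective (e ∷ β) {zero}  {zero}  eq = ≡.refl
label-injective (e ∷ β) {zero}  {suc j} eq = contradiction eq Finₚ.fromℕ≢inject₁
label-injective (e ∷ β) {suc i} {zero}  eq = contradiction (≡.sym eq) Finₚ.fromℕ≢inject₁
label-injective (e ∷ β) {suc i} {suc j} eq = cong suc (label-injective β (Finₚ.inject₁-injective eq))

reads : ∀ {m n} → (Fin m → Fin n) → Vec (Colour m) n → Bool
reads π ns = allᵇ (λ k → does (Vec.lookup ns (π k) ≟ suc k)) (allFin _)

-- Row operators and the exchange of adjacent rows

module RowTransfer {c ℓ : Level} (R : CommutativeRing c ℓ) (K : ℕ) (κ : CommutativeRing.Carrier R) where
  open CommutativeRing R hiding (zero)
  open FiniteSums R
  open import Relation.Binary.Reasoning.Setoid setoid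
  open import Algebra.Properties.Ring ring using (-‿distribˡ-*; -‿involutive)
  open NatSolver commutativeSemiring using (solve; _:=_; _:+_; _:*_; con)

  colours : List (Colour K)
  colours = allFin (suc K)

  σ : Colour K → Colour K → Carrier
  σ zero zero = - 1#
  σ _    _    = 1#

  σ-comm : ∀ a b → σ a b ≈ σ b a
  σ-comm zero    zero    = refl
  σ-comm zero    (suc _) = refl
  σ-comm (suc _) zero    = refl
  σ-comm (suc _) (suc _) = refl

  σ² : ∀ a b → σ a b * σ a b ≈ 1#
  σ² zero    zero    = trans (sym (-‿distribˡ-* 1# (- 1#))) (trans (-‿cong (*-identityˡ _)) (-‿involutive 1#))
  σ² zero    (suc _) = *-identityˡ _
  σ² (suc _) _       = *-identityˡ _

  -- p is the colour entering at the West; no pipe exits at the East.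
  Tʷ : ∀ {n} → (ℕ → Carrier) → Colour K → Vec (Colour K) n → Vec (Colour K) n → Carrier
  Tʷ u p []      []      = δ p zero
  Tʷ u p (s ∷ ss) (n ∷ ns) =
    (σ p s * u 0 * δ n s) * Tʷ (u ∘ suc) p ss ns + (κ * δ n p) * Tʷ (u ∘ suc) s ss ns

  -- b is the colour entering at the East, a the colour exiting at the West.
  Tᵉ : ∀ {n} → (ℕ → Carrier) → Colour K → Colour K → Vec (Colour K) n → Vec (Colour K) n → Carrier
  Tᵉ v b a []      []      = δ a b
  Tᵉ v b a (s ∷ ss) (n ∷ ns) =
    (σ a s * v 0 * δ n s) * Tᵉ (v ∘ suc) b a ss ns + (κ * δ a s) * Tᵉ (v ∘ suc) b n ss ns

  ColourMatrix : Set c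
  ColourMatrix = Colour K → Colour K → Carrier

  -- Effect of adding one column with South colour s and North colour n; t stands for ∑ U a a.
  stepU : (u v : Carrier) (s n : Colour K) → ColourMatrix → Carrier → ColourMatrix
  stepU u v s n U t p r =
    (σ p s * σ r s * (u * v) * δ n s) * U p r + (σ r s * (v * κ) * δ n p) * U s r
    + (κ * u * δ r s * σ p n) * U p n + (κ * κ * δ r s * δ n p) * t

  stepV : (u v : Carrier) (s n : Colour K) → ColourMatrix → ColourMatrix
  stepV u v s n V p r =
    (σ p s * σ r s * (u * v) * δ n s) * V p r + (σ p s * (u * κ) * δ r s) * V p n
    + (κ * v * δ n p * σ r n) * V s r + (κ * κ * δ r p) * V s n

  Exchange : Carrier → ColourMatrix → ColourMatrix → Carrier → Set ℓ
  Exchange z U V q =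
    (∀ p r → V p r ≈ σ p r * U p r + κ * δ p r * q) × (∑ colours (λ a → U a a) ≈ z * q)

  module _ {z u v : Carrier} (u+v≈z : u + v ≈ z) (s n : Colour K)
           {U V : ColourMatrix} {q : Carrier} (ex : Exchange z U V q) where

    -- The new quotient of the trace. The first summand comes from two straight tiles; the second
    -- from two elbows in the `stepV` order, where `p` turns North and then leaves as `r`, so that
    -- the term carries `δ r p`.
    q′ : Carrier
    q′ = (u * v) * δ n s * q + κ * V s n

    private
      V≈ = proj₁ ex
      ∑U≈ = proj₂ ex

      σσδ : ∀ p r → σ p s * σ r s * δ p r ≈ δ p r
      σσδ p r = begin
        σ p s * σ r s * δ p r   ≈⟨ solve 3 (λ a b d → a :* b :* d := d :* (a :* b)) refl _ _ _ ⟩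
        δ p r * (σ p s * σ r s) ≈⟨ δ-subst (λ a → σ a s * σ r s) p r ⟩
        δ p r * (σ r s * σ r s) ≈⟨ *-congˡ (σ² r s) ⟩
        δ p r * 1#              ≈⟨ *-identityʳ _ ⟩
        δ p r                   ∎

      straight-straight : ∀ p r →
        (σ p s * σ r s * (u * v) * δ n s) * V p r ≈
        σ p r * ((σ p s * σ r s * (u * v) * δ n s) * U p r) + κ * δ p r * ((u * v) * δ n s * q)
      straight-straight p r = begin
        (σ p s * σ r s * (u * v) * δ n s) * V p r
          ≈⟨ *-congˡ (V≈ p r) ⟩
        (σ p s * σ r s * (u * v) * δ n s) * (σ p r * U p r + κ * δ p r * q)
          ≈⟨ solve 9 (λ σ₁ σ₂ m dns σ₁₂ X k d q →
               (σ₁ :* σ₂ :* m :* dns) :* (σ₁₂ :* X :+ k :* d :* q) :=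
               σ₁₂ :* ((σ₁ :* σ₂ :* m :* dns) :* X) :+ (k :* (σ₁ :* σ₂ :* d)) :* (m :* dns :* q))
               refl _ _ _ _ _ _ _ _ _ ⟩
        σ p r * ((σ p s * σ r s * (u * v) * δ n s) * U p r) + (κ * (σ p s * σ r s * δ p r)) * ((u * v) * δ n s * q)
          ≈⟨ +-congˡ (*-congʳ (*-congˡ (σσδ p r))) ⟩
        σ p r * ((σ p s * σ r s * (u * v) * δ n s) * U p r) + κ * δ p r * ((u * v) * δ n s * q) ∎

      straight-elbow : ∀ p r →
        (σ p s * (u * κ) * δ r s) * V p n ≈
        σ p r * ((κ * u * δ r s * σ p n) * U p n) + σ p r * (κ * κ * δ r s * δ n p) * (u * q)
      straight-elbow p r = begin
        (σ p s * (u * κ) * δ r s) * V p n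
          ≈⟨ *-congˡ (V≈ p n) ⟩
        (σ p s * (u * κ) * δ r s) * (σ p n * U p n + κ * δ p n * q)
          ≈⟨ solve 8 (λ σ₁ m k d σ₂ X d₂ q →
               (σ₁ :* (m :* k) :* d) :* (σ₂ :* X :+ k :* d₂ :* q) :=
               (d :* σ₁) :* ((k :* m) :* σ₂ :* X :+ k :* k :* d₂ :* (m :* q)))
               refl _ _ _ _ _ _ _ _ ⟩
        (δ r s * σ p s) * ((κ * u) * σ p n * U p n + κ * κ * δ p n * (u * q))
          ≈⟨ *-cong (sym (δ-subst (σ p) r s)) (+-congˡ (*-congʳ (*-congˡ (δ-sym p n)))) ⟩
        (δ r s * σ p r) * ((κ * u) * σ p n * U p n + κ * κ * δ n p * (u * q))
          ≈⟨ solve 8 (λ σ₁ m k d σ₂ X d₂ q →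
               (d :* σ₁) :* ((k :* m) :* σ₂ :* X :+ k :* k :* d₂ :* (m :* q)) :=
               σ₁ :* ((k :* m :* d :* σ₂) :* X) :+ σ₁ :* (k :* k :* d :* d₂) :* (m :* q))
               refl _ _ _ _ _ _ _ _ ⟩
        σ p r * ((κ * u * δ r s * σ p n) * U p n) + σ p r * (κ * κ * δ r s * δ n p) * (u * q) ∎

      elbow-straight : ∀ p r →
        (κ * v * δ n p * σ r n) * V s r ≈
        σ p r * ((σ r s * (v * κ) * δ n p) * U s r) + σ p r * (κ * κ * δ r s * δ n p) * (v * q)
      elbow-straight p r = begin
        (κ * v * δ n p * σ r n) * V s r
          ≈⟨ *-congˡ (V≈ s r) ⟩
        (κ * v * δ n p * σ r n) * (σ s r * U s r + κ * δ s r * q)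
          ≈⟨ solve 8 (λ σ₁ m k d σ₂ X d₂ q →
               (k :* m :* d :* σ₁) :* (σ₂ :* X :+ k :* d₂ :* q) :=
               (d :* σ₁) :* ((m :* k) :* σ₂ :* X :+ k :* k :* d₂ :* (m :* q)))
               refl _ _ _ _ _ _ _ _ ⟩
        (δ n p * σ r n) * ((v * κ) * σ s r * U s r + κ * κ * δ s r * (v * q))
          ≈⟨ *-cong (trans (δ-subst (σ r) n p) (*-congˡ (σ-comm r p)))
                    (+-cong (*-congʳ (*-congˡ (σ-comm s r))) (*-congʳ (*-congˡ (δ-sym s r)))) ⟩
        (δ n p * σ p r) * ((v * κ) * σ r s * U s r + κ * κ * δ r s * (v * q))
          ≈⟨ solve 8 (λ σ₁ m k d σ₂ X d₂ q →
               (d :* σ₁) :* ((m :* k) :* σ₂ :* X :+ k :* k :* d₂ :* (m :* q)) :=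
               σ₁ :* ((σ₂ :* (m :* k) :* d) :* X) :+ σ₁ :* (k :* k :* d₂ :* d) :* (m :* q))
               refl _ _ _ _ _ _ _ _ ⟩
        σ p r * ((σ r s * (v * κ) * δ n p) * U s r) + σ p r * (κ * κ * δ r s * δ n p) * (v * q) ∎

      V′≈ : ∀ p r → stepV u v s n V p r ≈ σ p r * stepU u v s n U (z * q) p r + κ * δ p r * q′
      V′≈ p r = begin
        stepV u v s n V p r
          ≈⟨ +-cong (+-cong (+-cong (straight-straight p r) (straight-elbow p r)) (elbow-straight p r))
                    (*-congʳ (*-congˡ (δ-sym r p))) ⟩
        ((σ p r * A₁ + κ * δ p r * B) + (σ p r * A₃ + σ p r * D * (u * q))
          + (σ p r * A₂ + σ p r * D * (v * q))) + (κ * κ * δ p r) * V s n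
          ≈⟨ solve 12 (λ x a₁ a₂ a₃ k d b D u v q V →
               ((x :* a₁ :+ k :* d :* b) :+ (x :* a₃ :+ x :* D :* (u :* q))
                 :+ (x :* a₂ :+ x :* D :* (v :* q))) :+ (k :* k :* d) :* V :=
               x :* (a₁ :+ a₂ :+ a₃ :+ D :* ((u :+ v) :* q)) :+ k :* d :* (b :+ k :* V))
               refl _ _ _ _ _ _ _ _ _ _ _ _ ⟩
        σ p r * (A₁ + A₂ + A₃ + D * ((u + v) * q)) + κ * δ p r * q′
          ≈⟨ +-congʳ (*-congˡ (+-congˡ (*-congˡ (*-congʳ u+v≈z)))) ⟩
        σ p r * stepU u v s n U (z * q) p r + κ * δ p r * q′ ∎
        where
        A₁ = (σ p s * σ r s * (u * v) * δ n s) * U p r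
        A₂ = (σ r s * (v * κ) * δ n p) * U s r
        A₃ = (κ * u * δ r s * σ p n) * U p n
        B  = (u * v) * δ n s * q
        D  = κ * κ * δ r s * δ n p

      -- On the diagonal the deltas put a = n in one mixed term and a = s in the other, so both
      -- become multiples of `U s n`, with coefficients `v` and `u`. Hence `z` factors out of their
      -- sum, as it does out of the two terms containing `z * q`; the cofactor is `q′` by the first
      -- relation at s, n.
      ∑U′≈ : ∑ colours (λ a → stepU u v s n U (z * q) a a) ≈ z * q′
      ∑U′≈ = begin
        ∑ colours (λ a → stepU u v s n U (z * q) a a)
          ≈⟨ ∑-cong colours (λ a → +-cong (+-cong (+-cong
               (*-congʳ (trans (*-assoc _ _ _) (trans (*-congʳ (σ² a s)) (*-identityˡ _))))
               (trans (*-congʳ (*-congˡ (δ-sym n a)))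
                      (solve 4 (λ x y d m → (x :* y :* d) :* m := d :* (x :* y :* m)) refl _ _ _ _)))
               (solve 5 (λ k u d x m → (k :* u :* d :* x) :* m := d :* (k :* u :* x :* m)) refl _ _ _ _ _))
               (solve 4 (λ k d x m → (k :* k :* d :* x) :* m := d :* (k :* k :* x :* m)) refl _ _ _ _)) ⟩
        ∑ colours (λ a → ((u * v) * δ n s) * U a a + δ a n * (σ a s * (v * κ) * U s a)
                          + δ a s * (κ * u * σ a n * U a n) + δ a s * (κ * κ * δ n a * (z * q)))
          ≈⟨ trans (∑-+ colours _ _) (+-congʳ (trans (∑-+ colours _ _) (+-congʳ (∑-+ colours _ _)))) ⟩
        ∑ colours (λ a → ((u * v) * δ n s) * U a a) + ∑ colours (λ a → δ a n * (σ a s * (v * κ) * U s a))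
          + ∑ colours (λ a → δ a s * (κ * u * σ a n * U a n)) + ∑ colours (λ a → δ a s * (κ * κ * δ n a * (z * q)))
          ≈⟨ +-cong (+-cong (+-cong (trans (sym (*-∑ colours _ _)) (*-congˡ ∑U≈))
               (trans (∑-δ n _) (*-congʳ (*-congʳ (σ-comm n s))))) (∑-δ s _)) (∑-δ s _) ⟩
        ((u * v) * δ n s) * (z * q) + σ s n * (v * κ) * U s n + κ * u * σ s n * U s n + κ * κ * δ n s * (z * q)
          ≈⟨ solve 8 (λ u v d z q x k X →
               ((u :* v) :* d) :* (z :* q) :+ x :* (v :* k) :* X :+ k :* u :* x :* X :+ k :* k :* d :* (z :* q) :=
               z :* ((u :* v) :* d :* q) :+ (u :+ v) :* (k :* (x :* X)) :+ z :* (k :* (k :* d :* q)))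
               refl _ _ _ _ _ _ _ _ ⟩
        z * ((u * v) * δ n s * q) + (u + v) * (κ * (σ s n * U s n)) + z * (κ * (κ * δ n s * q))
          ≈⟨ +-cong (+-congˡ (*-congʳ u+v≈z)) (*-congˡ (*-congˡ (*-congʳ (*-congˡ (δ-sym n s))))) ⟩
        z * ((u * v) * δ n s * q) + z * (κ * (σ s n * U s n)) + z * (κ * (κ * δ s n * q))
          ≈⟨ solve 5 (λ z b k x y →
               z :* b :+ z :* (k :* x) :+ z :* (k :* y) := z :* (b :+ k :* (x :+ y)))
               refl _ _ _ _ _ ⟩
        z * ((u * v) * δ n s * q + κ * (σ s n * U s n + κ * δ s n * q))
          ≈⟨ *-congˡ (+-congˡ (*-congˡ (sym (V≈ s n)))) ⟩
        z * q′ ∎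

    exchange-step : Exchange z (stepU u v s n U (z * q)) (stepV u v s n V) q′
    exchange-step = V′≈ , ∑U′≈

  ∑-bilinear : {X : Set} (xs : List X) (a b a′ b′ : Carrier) (f g f′ g′ : X → Carrier) →
    ∑ xs (λ i → (a * f i + b * g i) * (a′ * f′ i + b′ * g′ i)) ≈
    (a * a′) * ∑ xs (λ i → f i * f′ i) + (a * b′) * ∑ xs (λ i → f i * g′ i)
    + (b * a′) * ∑ xs (λ i → g i * f′ i) + (b * b′) * ∑ xs (λ i → g i * g′ i)
  ∑-bilinear xs a b a′ b′ f g f′ g′ = begin
    ∑ xs (λ i → (a * f i + b * g i) * (a′ * f′ i + b′ * g′ i))
      ≈⟨ ∑-cong xs (λ i → solve 8 (λ a b a′ b′ f g f′ g′ →
           (a :* f :+ b :* g) :* (a′ :* f′ :+ b′ :* g′) :=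
           (a :* a′) :* (f :* f′) :+ (a :* b′) :* (f :* g′) :+ (b :* a′) :* (g :* f′) :+ (b :* b′) :* (g :* g′))
           refl _ _ _ _ _ _ _ _) ⟩
    ∑ xs (λ i → (a * a′) * (f i * f′ i) + (a * b′) * (f i * g′ i)
                + (b * a′) * (g i * f′ i) + (b * b′) * (g i * g′ i))
      ≈⟨ trans (∑-+ xs _ _) (+-congʳ (trans (∑-+ xs _ _) (+-congʳ (∑-+ xs _ _)))) ⟩
    ∑ xs (λ i → (a * a′) * (f i * f′ i)) + ∑ xs (λ i → (a * b′) * (f i * g′ i))
      + ∑ xs (λ i → (b * a′) * (g i * f′ i)) + ∑ xs (λ i → (b * b′) * (g i * g′ i))
      ≈⟨ +-cong (+-cong (+-cong (*-∑ xs _ _) (*-∑ xs _ _)) (*-∑ xs _ _)) (*-∑ xs _ _) ⟨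
    _ ∎

  ∑-+₄ : {X : Set} (xs : List X) (f g h k : X → Carrier) →
    ∑ xs (λ i → f i + g i + h i + k i) ≈ ∑ xs f + ∑ xs g + ∑ xs h + ∑ xs k
  ∑-+₄ xs f g h k = trans (∑-+ xs _ _) (+-congʳ (trans (∑-+ xs _ _) (+-congʳ (∑-+ xs _ _))))

  -- Products of two row operators, one column at a time

  lines : (n : ℕ) → List (Vec (Colour K) n)
  lines = vecs colours

  -- The row written first is the lower one.
  TᵉTʷ TʷTᵉ : ∀ {n} → (u v : ℕ → Carrier) → Colour K → Vec (Colour K) n → Vec (Colour K) n → ColourMatrix
  TᵉTʷ {n} u v b ss ns p r = ∑ (lines n) (λ ms → Tᵉ v b r ss ms * Tʷ u p ms ns)
  TʷTᵉ {n} u v b ss ns p r = ∑ (lines n) (λ ms → Tʷ u p ss ms * Tᵉ v b r ms ns)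

  -- The four terms are the choices of straight or elbow in the two rows. In the term with two
  -- elbows no delta constrains the middle colour `a`, whence the trace.
  TᵉTʷ-step : ∀ {k} u v b s n (ss ns : Vec (Colour K) k) p r →
    TᵉTʷ u v b (s ∷ ss) (n ∷ ns) p r ≈
    stepU (u 0) (v 0) s n (TᵉTʷ (u ∘ suc) (v ∘ suc) b ss ns)
      (∑ colours (λ a → TᵉTʷ (u ∘ suc) (v ∘ suc) b ss ns a a)) p r
  TᵉTʷ-step {k} u v b s n ss ns p r = begin
    TᵉTʷ u v b (s ∷ ss) (n ∷ ns) p r
      ≈⟨ ∑-vecs colours k _ ⟩
    ∑ colours (λ a → ∑ (lines k) (λ ms →
      ((σ r s * v 0 * δ a s) * Tᵉ (v ∘ suc) b r ss ms + (κ * δ r s) * Tᵉ (v ∘ suc) b a ss ms)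
      * ((σ p a * u 0 * δ n a) * Tʷ (u ∘ suc) p ms ns + (κ * δ n p) * Tʷ (u ∘ suc) a ms ns)))
      ≈⟨ ∑-cong colours (λ a → ∑-bilinear (lines k) _ _ _ _ _ _ _ _) ⟩
    ∑ colours (λ a →
      ((σ r s * v 0 * δ a s) * (σ p a * u 0 * δ n a)) * U p r
      + ((σ r s * v 0 * δ a s) * (κ * δ n p)) * U a r
      + ((κ * δ r s) * (σ p a * u 0 * δ n a)) * U p a
      + ((κ * δ r s) * (κ * δ n p)) * U a a)
      ≈⟨ ∑-cong colours (λ a → +-cong (+-cong (+-cong
           (solve 7 (λ x v d y u d′ X → ((x :* v :* d) :* (y :* u :* d′)) :* X := d :* ((y :* x :* (u :* v) :* d′) :* X)) refl _ _ _ _ _ _ _)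
           (solve 6 (λ x v d k d′ X → ((x :* v :* d) :* (k :* d′)) :* X := d :* ((x :* (v :* k) :* d′) :* X)) refl _ _ _ _ _ _))
           (trans (*-congʳ (*-congˡ (*-congˡ (δ-sym n a))))
             (solve 6 (λ k d x u d′ X → ((k :* d) :* (x :* u :* d′)) :* X := d′ :* ((k :* u :* d :* x) :* X)) refl _ _ _ _ _ _)))
           (*-congʳ (solve 3 (λ k d d′ → (k :* d) :* (k :* d′) := k :* k :* d :* d′) refl _ _ _))) ⟩
    ∑ colours (λ a →
      δ a s * ((σ p a * σ r s * (u 0 * v 0) * δ n a) * U p r)
      + δ a s * ((σ r s * (v 0 * κ) * δ n p) * U a r)
      + δ a n * ((κ * u 0 * δ r s * σ p a) * U p a)
      + (κ * κ * δ r s * δ n p) * U a a)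
      ≈⟨ ∑-+₄ colours _ _ _ _ ⟩
    _
      ≈⟨ +-cong (+-cong (+-cong (∑-δ s _) (∑-δ s _)) (∑-δ n _)) (sym (*-∑ colours _ _)) ⟩
    stepU (u 0) (v 0) s n U (∑ colours (λ a → U a a)) p r ∎
    where
    U = TᵉTʷ (u ∘ suc) (v ∘ suc) b ss ns

  -- In this order every choice of tiles fixes the middle colour: it is `s` if the lower tile is
  -- straight and `p` if it is an elbow. No trace arises.
  TʷTᵉ-step : ∀ {k} u v b s n (ss ns : Vec (Colour K) k) p r →
    TʷTᵉ u v b (s ∷ ss) (n ∷ ns) p r ≈
    stepV (u 0) (v 0) s n (TʷTᵉ (u ∘ suc) (v ∘ suc) b ss ns) p r
  TʷTᵉ-step {k} u v b s n ss ns p r = begin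
    TʷTᵉ u v b (s ∷ ss) (n ∷ ns) p r
      ≈⟨ ∑-vecs colours k _ ⟩
    ∑ colours (λ a → ∑ (lines k) (λ ms →
      ((σ p s * u 0 * δ a s) * Tʷ (u ∘ suc) p ss ms + (κ * δ a p) * Tʷ (u ∘ suc) s ss ms)
      * ((σ r a * v 0 * δ n a) * Tᵉ (v ∘ suc) b r ms ns + (κ * δ r a) * Tᵉ (v ∘ suc) b n ms ns)))
      ≈⟨ ∑-cong colours (λ a → ∑-bilinear (lines k) _ _ _ _ _ _ _ _) ⟩
    ∑ colours (λ a →
      ((σ p s * u 0 * δ a s) * (σ r a * v 0 * δ n a)) * V p r
      + ((σ p s * u 0 * δ a s) * (κ * δ r a)) * V p n
      + ((κ * δ a p) * (σ r a * v 0 * δ n a)) * V s r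
      + ((κ * δ a p) * (κ * δ r a)) * V s n)
      ≈⟨ ∑-cong colours (λ a → +-cong (+-cong (+-cong
           (solve 7 (λ x u d y v d′ X → ((x :* u :* d) :* (y :* v :* d′)) :* X := d :* ((x :* y :* (u :* v) :* d′) :* X)) refl _ _ _ _ _ _ _)
           (solve 6 (λ x u d k d′ X → ((x :* u :* d) :* (k :* d′)) :* X := d :* ((x :* (u :* k) :* d′) :* X)) refl _ _ _ _ _ _))
           (solve 6 (λ k d x v d′ X → ((k :* d) :* (x :* v :* d′)) :* X := d :* ((k :* v :* d′ :* x) :* X)) refl _ _ _ _ _ _))
           (solve 4 (λ k d d′ X → ((k :* d) :* (k :* d′)) :* X := d :* ((k :* k :* d′) :* X)) refl _ _ _ _)) ⟩
    ∑ colours (λ a →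
      δ a s * ((σ p s * σ r a * (u 0 * v 0) * δ n a) * V p r)
      + δ a s * ((σ p s * (u 0 * κ) * δ r a) * V p n)
      + δ a p * ((κ * v 0 * δ n a * σ r a) * V s r)
      + δ a p * ((κ * κ * δ r a) * V s n))
      ≈⟨ ∑-+₄ colours _ _ _ _ ⟩
    _
      ≈⟨ +-cong (+-cong (+-cong (∑-δ s _) (∑-δ s _)) (∑-δ p _)) (∑-δ p _) ⟩
    (σ p s * σ r s * (u 0 * v 0) * δ n s) * V p r + (σ p s * (u 0 * κ) * δ r s) * V p n
      + (κ * v 0 * δ n p * σ r p) * V s r + (κ * κ * δ r p) * V s n
      -- On the support of `δ n p` the sign may be read at `n` instead of `p`, the form in which
      -- `stepV` records it.
      ≈⟨ +-congʳ (+-congˡ (*-congʳ (trans (*-assoc _ _ _) (trans (*-congˡ (sym (δ-subst (σ r) n p))) (sym (*-assoc _ _ _)))))) ⟩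
    stepV (u 0) (v 0) s n V p r ∎
    where
    V = TʷTᵉ (u ∘ suc) (v ∘ suc) b ss ns

  -- With no columns left, U and V both require p blank and r the pipe entering at the East. These
  -- colours differ, so the sign is 1 wherever the product is nonzero, the trace vanishes, and q = 0
  -- starts the recursion.
  exchange : ∀ {k} {z} {u v : ℕ → Carrier} → (∀ j → u j + v j ≈ z) → ∀ (b : Fin K) (ss ns : Vec (Colour K) k) →
    ∃[ q ] Exchange z (TᵉTʷ u v (suc b) ss ns) (TʷTᵉ u v (suc b) ss ns) q
  exchange {z = z} u+v≈z b [] [] = 0# , V≈ , ∑U≈
    where
    V≈ : ∀ p r → δ p zero * δ r (suc b) + 0# ≈ σ p r * (δ r (suc b) * δ p zero + 0#) + κ * δ p r * 0#
    V≈ (suc p) r = begin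
      0# * δ r (suc b) + 0#
        ≈⟨ solve 3 (λ x k d → con 0 :* x :+ con 0 := con 1 :* (x :* con 0 :+ con 0) :+ k :* d :* con 0) refl _ _ _ ⟩
      1# * (δ r (suc b) * 0# + 0#) + κ * δ (suc p) r * 0# ∎
    V≈ zero zero = solve 2 (λ x k → con 1 :* con 0 :+ con 0 := x :* (con 0 :* con 1 :+ con 0) :+ k :* con 1 :* con 0) refl _ _
    V≈ zero (suc r) = solve 2 (λ x k → con 1 :* x :+ con 0 := con 1 :* (x :* con 1 :+ con 0) :+ k :* con 0 :* con 0) refl _ _
    ∑U≈ : ∑ colours (λ a → δ a (suc b) * δ a zero + 0#) ≈ z * 0#
    ∑U≈ = trans (∑-zero colours vanish) (sym (zeroʳ z))
      where
      vanish : ∀ a → δ a (suc b) * δ a zero + 0# ≈ 0#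
      vanish zero    = trans (+-identityʳ _) (zeroˡ _)
      vanish (suc a) = trans (+-identityʳ _) (zeroʳ _)
  exchange {z = z} {u} {v} u+v≈z b (s ∷ ss) (n ∷ ns)
    with exchange (u+v≈z ∘ suc) b ss ns
  ... | q , ex = q′ (u+v≈z 0) s n ex , V≈ , ∑U≈
    where
    U V : ColourMatrix
    U = TᵉTʷ (u ∘ suc) (v ∘ suc) (suc b) ss ns
    V = TʷTᵉ (u ∘ suc) (v ∘ suc) (suc b) ss ns
    U-step : ∀ p r → TᵉTʷ u v (suc b) (s ∷ ss) (n ∷ ns) p r ≈ stepU (u 0) (v 0) s n U (z * q) p r
    U-step p r = trans (TᵉTʷ-step u v (suc b) s n ss ns p r) (+-congˡ (*-congˡ (proj₂ ex)))
    ex′ = exchange-step (u+v≈z 0) s n ex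
    V≈ : ∀ p r → TʷTᵉ u v (suc b) (s ∷ ss) (n ∷ ns) p r ≈
      σ p r * TᵉTʷ u v (suc b) (s ∷ ss) (n ∷ ns) p r + κ * δ p r * q′ (u+v≈z 0) s n ex
    V≈ p r = trans (TʷTᵉ-step u v (suc b) s n ss ns p r)
      (trans (proj₁ ex′ p r) (+-congʳ (*-congˡ (sym (U-step p r)))))
    ∑U≈ : ∑ colours (λ a → TᵉTʷ u v (suc b) (s ∷ ss) (n ∷ ns) a a) ≈ z * q′ (u+v≈z 0) s n ex
    ∑U≈ = trans (∑-cong colours (λ a → U-step a a)) (proj₂ ex′)

  rows-commute : ∀ {k} {z} {u v : ℕ → Carrier} → (∀ j → u j + v j ≈ z) → ∀ (a b : Fin K) (ss ns : Vec (Colour K) k) →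
    TʷTᵉ u v (suc b) ss ns (suc a) zero ≈ TᵉTʷ u v (suc b) ss ns (suc a) zero
  rows-commute u+v≈z a b ss ns with exchange u+v≈z b ss ns
  ... | q , V≈ , _ = trans (V≈ (suc a) zero) (trans (+-cong (*-identityˡ _) (trans (*-congʳ (zeroʳ κ)) (zeroˡ q))) (+-identityʳ _))

  -- The bottom row

  blanks : ∀ n → Vec (Colour K) n
  blanks n = Vec.replicate n zero

  -- Above a blank line the row contains no colour but `b` and blank, so no other pipe can leave it.
  Tᵉ-absent : ∀ {n} v b a (ns : Vec (Colour K) n) → suc a ≢ b → Tᵉ v b (suc a) (blanks n) ns ≈ 0#
  Tᵉ-absent v b a []       a≢b = δ-≢ a≢b
  Tᵉ-absent v b a (n ∷ ns) a≢b = begin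
    (1# * v 0 * δ n zero) * Tᵉ (v ∘ suc) b (suc a) (blanks _) ns + (κ * 0#) * Tᵉ (v ∘ suc) b n (blanks _) ns
      ≈⟨ +-congʳ (*-congˡ (Tᵉ-absent (v ∘ suc) b a ns a≢b)) ⟩
    (1# * v 0 * δ n zero) * 0# + (κ * 0#) * Tᵉ (v ∘ suc) b n (blanks _) ns
      ≈⟨ solve 3 (λ x k y → x :* con 0 :+ (k :* con 0) :* y := con 0) refl _ _ _ ⟩
    0# ∎

  -- With two blank incoming colours, straight and elbow have the same outcome; their signed sum is
  -- the weight of the blank tile.
  cancel-sign : ∀ {x y} → x + y ≈ κ → - 1# * x + κ ≈ y
  cancel-sign {x} {y} x+y≈κ = begin
    - 1# * x + κ
      ≈⟨ +-cong (trans (sym (-‿distribˡ-* 1# x)) (-‿cong (*-identityˡ x))) (sym x+y≈κ) ⟩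
    - x + (x + y)
      ≈⟨ +-assoc _ _ _ ⟨
    (- x + x) + y
      ≈⟨ trans (+-congʳ (-‿inverseˡ x)) (+-identityˡ y) ⟩
    y ∎

  -- Both sides force blank North edges. A cell contributes κ - u on the left as a blank tile of
  -- type `w`, and `v` on the right as a straight tile of type `e`.
  Tʷ-blank≈Tᵉ : ∀ {n} {u v : ℕ → Carrier} → (∀ j → u j + v j ≈ κ) → ∀ b (ns : Vec (Colour K) n) →
    Tʷ u zero (blanks n) ns ≈ Tᵉ v (suc b) (suc b) (blanks n) ns
  Tʷ-blank≈Tᵉ u+v≈κ b [] = sym (δ-refl (suc b))
  Tʷ-blank≈Tᵉ {suc k} {u} {v} u+v≈κ b (n ∷ ns) = begin
    (- 1# * u 0 * δ n zero) * X + (κ * δ n zero) * X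
      ≈⟨ solve 5 (λ m u d k X → (m :* u :* d) :* X :+ (k :* d) :* X := (m :* u :+ k) :* d :* X) refl _ _ _ _ _ ⟩
    (- 1# * u 0 + κ) * δ n zero * X
      ≈⟨ *-cong (*-congʳ (cancel-sign (u+v≈κ 0))) (Tʷ-blank≈Tᵉ (u+v≈κ ∘ suc) b ns) ⟩
    v 0 * δ n zero * Y
      ≈⟨ solve 5 (λ v d Y k Z → v :* d :* Y := (con 1 :* v :* d) :* Y :+ (k :* con 0) :* Z) refl _ _ _ _ _ ⟩
    (1# * v 0 * δ n zero) * Y + (κ * 0#) * Tᵉ (v ∘ suc) (suc b) n (blanks k) ns ∎
    where
    X = Tʷ (u ∘ suc) zero (blanks k) ns
    Y = Tᵉ (v ∘ suc) (suc b) (suc b) (blanks k) ns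

  -- The single pipe turns North in the same column for both types. Before that column the `w` row
  -- is straight where the `e` row is blank, after it the roles are exchanged, and straight in one
  -- type weighs the same as blank in the other.
  bottom-row : ∀ {n} {u v : ℕ → Carrier} → (∀ j → u j + v j ≈ κ) → ∀ b (ns : Vec (Colour K) n) →
    Tʷ u (suc b) (blanks n) ns ≈ Tᵉ v (suc b) zero (blanks n) ns
  bottom-row u+v≈κ b [] = refl
  bottom-row {suc k} {u} {v} u+v≈κ b (zero ∷ ns) = begin
    (1# * u 0 * 1#) * X + (κ * 0#) * X₀
      ≈⟨ solve 4 (λ u X k X₀ → (con 1 :* u :* con 1) :* X :+ (k :* con 0) :* X₀ := u :* X) refl _ _ _ _ ⟩
    u 0 * X
      -- The pipe has not turned here: straight in the `w` row, blank in the `e` row, of weight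
      -- `u 0` = κ - `v 0`.
      ≈⟨ *-cong (sym (cancel-sign (trans (+-comm _ _) (u+v≈κ 0)))) (bottom-row (u+v≈κ ∘ suc) b ns) ⟩
    (- 1# * v 0 + κ) * Y
      ≈⟨ solve 4 (λ m v k Y → (m :* v :+ k) :* Y := (m :* v :* con 1) :* Y :+ (k :* con 1) :* Y) refl _ _ _ _ ⟩
    (- 1# * v 0 * 1#) * Y + (κ * 1#) * Y ∎
    where
    X  = Tʷ (u ∘ suc) (suc b) (blanks k) ns
    X₀ = Tʷ (u ∘ suc) zero (blanks k) ns
    Y  = Tᵉ (v ∘ suc) (suc b) zero (blanks k) ns
  bottom-row {suc k} {u} {v} u+v≈κ b (suc n ∷ ns) = begin
    (1# * u 0 * 0#) * X + (κ * δ (suc n) (suc b)) * X₀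
      ≈⟨ +-congˡ (trans (*-assoc _ _ _) (*-congˡ elbow)) ⟩
    (1# * u 0 * 0#) * X + κ * Yₙ
      ≈⟨ solve 6 (λ u X k y m v → (con 1 :* u :* con 0) :* X :+ k :* y := (m :* v :* con 0) :* X :+ (k :* con 1) :* y) refl _ _ _ _ _ _ ⟩
    (- 1# * v 0 * 0#) * X + (κ * 1#) * Yₙ
      ≈⟨ +-congʳ (solve 3 (λ x X Y → (x :* con 0) :* X := (x :* con 0) :* Y) refl _ _ _) ⟩
    (- 1# * v 0 * 0#) * Y + (κ * 1#) * Yₙ ∎
    where
    X  = Tʷ (u ∘ suc) (suc b) (blanks k) ns
    X₀ = Tʷ (u ∘ suc) zero (blanks k) ns
    Y  = Tᵉ (v ∘ suc) (suc b) zero (blanks k) ns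
    Yₙ = Tᵉ (v ∘ suc) (suc b) (suc n) (blanks k) ns
    -- The pipe turns in this column, so the North colour must be that of the pipe; any other pipe
    -- colour makes both sides zero.
    elbow : δ (suc n) (suc b) * X₀ ≈ Yₙ
    elbow with suc n ≟ suc b
    ... | yes ≡.refl = trans (trans (*-congʳ (δ-refl (suc b))) (*-identityˡ _)) (Tʷ-blank≈Tᵉ (u+v≈κ ∘ suc) b ns)
    ... | no  n≢b    = trans (trans (*-congʳ (δ-≢ n≢b)) (zeroˡ _)) (sym (Tᵉ-absent (v ∘ suc) (suc b) n ns n≢b))

-- Row operators as sums over tilings

module TileExpansion {c ℓ : Level} (R : CommutativeRing c ℓ) (K : ℕ) (κ : CommutativeRing.Carrier R) where
  open CommutativeRing R hiding (zero)
  open FiniteSums R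
  open RowTransfer R K κ
  open import Relation.Binary.Reasoning.Setoid setoid
  open NatSolver commutativeSemiring using (solve; _:=_; _:+_; _:*_; con)

  cellWeight : Carrier → Carrier → Tile → Carrier
  cellWeight u b t = if isElbow t then κ else if isStraight t then u else b

  -- Kept abstract: sums over an explicit list unfold and defeat unification.
  abstract
    tiles : List Tile
    tiles = allTiles

    tiles≡allTiles : tiles ≡ allTiles
    tiles≡allTiles = ≡.refl

  tileRows : (n : ℕ) → List (Vec Tile n)
  tileRows = vecs tiles

  rowWeight : ∀ {n} → (ℕ → Tile → Carrier) → Vec Tile n → Carrier
  rowWeight f ts = ∏ (λ j → f (toℕ j) (Vec.lookup ts j))

  -- For given incoming colours one straight tile and one elbow tile fit, except that two blanks
  -- admit the blank tile alone. Its weight κ - u is then split into the two terms on the right,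
  -- which have equal outcomes.
  tile-sum-cases : ∀ {u b} → u + b ≈ κ → ∀ p s n (X : Colour K → Carrier) →
    ∑ allTiles (λ t → cellWeight u b t * (ι (fits t p s) * (δ (north t p s) n * X (through t p s)))) ≈
    (σ p s * u * δ n s) * X p + (κ * δ n p) * X s
  tile-sum-cases {u} {b} u+b≈κ zero zero n X = begin
    _ ≈⟨ solve 5 (λ b u k d X →
           b :* (con 1 :* (d :* X)) :+ (u :* (con 0 :* (d :* X)) :+ (u :* (con 0 :* (d :* X)) :+ (u :* (con 0 :* (d :* X)) :+
           (k :* (con 0 :* (d :* X)) :+ (k :* (con 0 :* (d :* X)) :+ (k :* (con 0 :* (d :* X)) :+ con 0)))))) := b :* d :* X)
           refl b u κ (δ zero n) (X zero) ⟩
    b * δ zero n * X zero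
      ≈⟨ *-congʳ (*-cong (sym (cancel-sign u+b≈κ)) (δ-sym zero n)) ⟩
    (- 1# * u + κ) * δ n zero * X zero
      ≈⟨ solve 5 (λ m u k d X → (m :* u :+ k) :* d :* X := (m :* u :* d) :* X :+ (k :* d) :* X) refl _ _ _ _ _ ⟩
    _ ∎
  tile-sum-cases {u} {b} u+b≈κ zero (suc s) n X = begin
    _ ≈⟨ solve 7 (λ b u k d X d′ X′ →
           b :* (con 0 :* (d :* X)) :+ (u :* (con 0 :* (d :* X)) :+ (u :* (con 1 :* (d :* X)) :+ (u :* (con 0 :* (d :* X)) :+
           (k :* (con 0 :* (d′ :* X′)) :+ (k :* (con 1 :* (d′ :* X′)) :+ (k :* (con 0 :* (d′ :* X′)) :+ con 0))))))
           := con 1 :* u :* d :* X :+ k :* d′ :* X′)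
           refl b u κ (δ (suc s) n) (X zero) (δ zero n) (X (suc s)) ⟩
    _ ≈⟨ +-cong (*-congʳ (*-congˡ (δ-sym (suc s) n))) (*-congʳ (*-congˡ (δ-sym zero n))) ⟩
    _ ∎
  tile-sum-cases {u} {b} u+b≈κ (suc p) zero n X = begin
    _ ≈⟨ solve 7 (λ b u k d X d′ X′ →
           b :* (con 0 :* (d :* X)) :+ (u :* (con 1 :* (d :* X)) :+ (u :* (con 0 :* (d :* X)) :+ (u :* (con 0 :* (d :* X)) :+
           (k :* (con 1 :* (d′ :* X′)) :+ (k :* (con 0 :* (d′ :* X′)) :+ (k :* (con 0 :* (d′ :* X′)) :+ con 0))))))
           := con 1 :* u :* d :* X :+ k :* d′ :* X′)
           refl b u κ (δ zero n) (X (suc p)) (δ (suc p) n) (X zero) ⟩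
    _ ≈⟨ +-cong (*-congʳ (*-congˡ (δ-sym zero n))) (*-congʳ (*-congˡ (δ-sym (suc p) n))) ⟩
    _ ∎
  tile-sum-cases {u} {b} u+b≈κ (suc p) (suc s) n X = begin
    _ ≈⟨ solve 7 (λ b u k d X d′ X′ →
           b :* (con 0 :* (d :* X)) :+ (u :* (con 0 :* (d :* X)) :+ (u :* (con 0 :* (d :* X)) :+ (u :* (con 1 :* (d :* X)) :+
           (k :* (con 0 :* (d′ :* X′)) :+ (k :* (con 0 :* (d′ :* X′)) :+ (k :* (con 1 :* (d′ :* X′)) :+ con 0))))))
           := con 1 :* u :* d :* X :+ k :* d′ :* X′)
           refl b u κ (δ (suc s) n) (X (suc p)) (δ (suc p) n) (X (suc s)) ⟩
    _ ≈⟨ +-cong (*-congʳ (*-congˡ (δ-sym (suc s) n))) (*-congʳ (*-congˡ (δ-sym (suc p) n))) ⟩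
    _ ∎

  tile-sum : ∀ {u b} → u + b ≈ κ → ∀ p s n (X : Colour K → Carrier) →
    ∑ tiles (λ t → cellWeight u b t * (ι (fits t p s) * (δ (north t p s) n * X (through t p s)))) ≈
    (σ p s * u * δ n s) * X p + (κ * δ n p) * X s
  tile-sum u+b≈κ p s n X rewrite tiles≡allTiles = tile-sum-cases u+b≈κ p s n X

  rowʷ-expansion : ∀ {n} {u b : ℕ → Carrier} → (∀ j → u j + b j ≈ κ) → ∀ p (ss ns : Vec (Colour K) n) →
    ∑ (tileRows n) (λ ts → rowWeight (λ j → cellWeight (u j) (b j)) ts * (ι (validʷ p ts ss) * δᵛ (northsʷ p ts ss) ns))
    ≈ Tʷ u p ss ns
  rowʷ-expansion u+b≈κ zero    [] [] = solve 0 (con 1 :* (con 1 :* con 1) :+ con 0 := con 1) refl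
  rowʷ-expansion u+b≈κ (suc p) [] [] = solve 0 (con 1 :* (con 0 :* con 1) :+ con 0 := con 0) refl
  rowʷ-expansion {suc k} {u} {b} u+b≈κ p (s ∷ ss) (n ∷ ns) = begin
    _ ≈⟨ ∑-vecs tiles k _ ⟩
    ∑ tiles (λ t → ∑ (tileRows k) (λ ts → (cellWeight (u 0) (b 0) t * wt ts)
      * (ι (fits t p s ∧ validʷ (through t p s) ts ss) * (δ (north t p s) n * δᵛ (northsʷ (through t p s) ts ss) ns))))
      ≈⟨ ∑-cong tiles (λ t → trans (∑-cong (tileRows k) (λ ts → trans
           (*-congˡ (*-congʳ (ι-∧ (fits t p s) _)))
           (solve 6 (λ c m f v d d′ → (c :* m) :* ((f :* v) :* (d :* d′)) := (c :* (f :* d)) :* (m :* (v :* d′))) refl _ _ _ _ _ _)))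
           (trans (sym (*-∑ (tileRows k) _ _)) (*-congˡ (rowʷ-expansion (u+b≈κ ∘ suc) (through t p s) ss ns)))) ⟩
    ∑ tiles (λ t → (cellWeight (u 0) (b 0) t * (ι (fits t p s) * δ (north t p s) n)) * Tʷ (u ∘ suc) (through t p s) ss ns)
      ≈⟨ ∑-cong tiles (λ t → solve 4 (λ c f d X → (c :* (f :* d)) :* X := c :* (f :* (d :* X))) refl _ _ _ _) ⟩
    _ ≈⟨ tile-sum (u+b≈κ 0) p s n (λ q → Tʷ (u ∘ suc) q ss ns) ⟩
    _ ∎
    where
    wt : Vec Tile k → Carrier
    wt = rowWeight (λ j → cellWeight (u (suc j)) (b (suc j)))

  -- The colour entering the first tile depends on all tiles to its right, so the sums are exchanged
  -- and the first tile is summed for a fixed tail.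
  rowᵉ-expansion : ∀ {n} {u b : ℕ → Carrier} → (∀ j → u j + b j ≈ κ) → ∀ k a (ss ns : Vec (Colour K) n) →
    ∑ (tileRows n) (λ ts → rowWeight (λ j → cellWeight (u j) (b j)) ts
      * (ι (fitsᵉ k ts ss) * δ (exitᵉ k ts ss) a * δᵛ (northsᵉ k ts ss) ns))
    ≈ Tᵉ u k a ss ns
  rowᵉ-expansion u+b≈κ k a [] [] = trans
    (solve 1 (λ d → con 1 :* (con 1 :* d :* con 1) :+ con 0 := d) refl (δ k a)) (δ-sym k a)
  rowᵉ-expansion {suc l} {u} {b} u+b≈κ k a (s ∷ ss) (n ∷ ns) = begin
    _ ≈⟨ ∑-vecs tiles l _ ⟩
    ∑ tiles (λ t → ∑ (tileRows l) (λ ts → (cellWeight (u 0) (b 0) t * wt ts)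
      * (ι (fits t (q ts) s ∧ fitsᵉ k ts ss) * δ (through t (q ts) s) a
         * (δ (north t (q ts) s) n * δᵛ (northsᵉ k ts ss) ns))))
      ≈⟨ ∑-swap tiles (tileRows l) _ ⟩
    ∑ (tileRows l) (λ ts → ∑ tiles (λ t → (cellWeight (u 0) (b 0) t * wt ts)
      * (ι (fits t (q ts) s ∧ fitsᵉ k ts ss) * δ (through t (q ts) s) a
         * (δ (north t (q ts) s) n * δᵛ (northsᵉ k ts ss) ns))))
      ≈⟨ ∑-cong (tileRows l) (λ ts → trans
           (∑-cong tiles (λ t → trans (*-congˡ (*-congʳ (*-congʳ (ι-∧ (fits t (q ts) s) _))))
             (solve 7 (λ c m f v d d′ D → (c :* m) :* ((f :* v) :* d :* (d′ :* D)) := (m :* (v :* D)) :* (c :* (f :* (d′ :* d))))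
                refl _ _ _ _ _ _ _)))
           (trans (sym (*-∑ tiles _ _)) (*-congˡ (trans
             (tile-sum (u+b≈κ 0) (q ts) s n (λ d → δ d a)) (exit-moved (q ts)))))) ⟩
    ∑ (tileRows l) (λ ts → (wt ts * (ι (fitsᵉ k ts ss) * δᵛ (northsᵉ k ts ss) ns))
      * ((σ a s * u 0 * δ n s) * δ (q ts) a + (κ * δ a s) * δ (q ts) n))
      ≈⟨ ∑-cong (tileRows l) (λ ts → solve 7 (λ m v D x y d d′ →
           (m :* (v :* D)) :* (x :* d :+ y :* d′) := x :* (m :* (v :* d :* D)) :+ y :* (m :* (v :* d′ :* D)))
           refl _ _ _ _ _ _ _) ⟩
    ∑ (tileRows l) (λ ts →
      (σ a s * u 0 * δ n s) * (wt ts * (ι (fitsᵉ k ts ss) * δ (q ts) a * δᵛ (northsᵉ k ts ss) ns))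
      + (κ * δ a s) * (wt ts * (ι (fitsᵉ k ts ss) * δ (q ts) n * δᵛ (northsᵉ k ts ss) ns)))
      ≈⟨ trans (∑-+ (tileRows l) _ _) (sym (+-cong (*-∑ (tileRows l) _ _) (*-∑ (tileRows l) _ _))) ⟩
    _ ≈⟨ +-cong (*-congˡ (rowᵉ-expansion (u+b≈κ ∘ suc) k a ss ns)) (*-congˡ (rowᵉ-expansion (u+b≈κ ∘ suc) k n ss ns)) ⟩
    _ ∎
    where
    wt : Vec Tile l → Carrier
    wt = rowWeight (λ j → cellWeight (u (suc j)) (b (suc j)))
    q : Vec Tile l → Colour K
    q ts = exitᵉ k ts ss
    -- `tile-sum` expresses the coefficients through the entering colour `d`, while `Tᵉ` expresses
    -- them through the exit colour `a`; the deltas allow the change.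
    exit-moved : ∀ d → (σ d s * u 0 * δ n s) * δ d a + (κ * δ n d) * δ s a ≈
                       (σ a s * u 0 * δ n s) * δ d a + (κ * δ a s) * δ d n
    exit-moved d = +-cong
      (begin
        (σ d s * u 0 * δ n s) * δ d a
          ≈⟨ solve 4 (λ x u d d′ → (x :* u :* d) :* d′ := (d′ :* x) :* (u :* d)) refl _ _ _ _ ⟩
        (δ d a * σ d s) * (u 0 * δ n s)
          ≈⟨ *-congʳ (δ-subst (λ f → σ f s) d a) ⟩
        (δ d a * σ a s) * (u 0 * δ n s)
          ≈⟨ solve 4 (λ x u d d′ → (d′ :* x) :* (u :* d) := (x :* u :* d) :* d′) refl _ _ _ _ ⟩
        (σ a s * u 0 * δ n s) * δ d a ∎)
      (begin
        (κ * δ n d) * δ s a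
          ≈⟨ solve 3 (λ k d d′ → (k :* d) :* d′ := (k :* d′) :* d) refl _ _ _ ⟩
        (κ * δ s a) * δ n d
          ≈⟨ *-cong (*-congˡ (δ-sym s a)) (δ-sym n d) ⟩
        (κ * δ a s) * δ d n ∎)

-- The partition function

module PartitionFunction {c ℓ : Level} (R : CommutativeRing c ℓ)
  (x y : ℕ → CommutativeRing.Carrier R) (A B : CommutativeRing.Carrier R) (K : ℕ) where
  open CommutativeRing R hiding (zero)
  open FiniteSums R
  open RowTransfer R K (A + B)
  open TileExpansion R K (A + B)
  open import Relation.Binary.Reasoning.Setoid setoid
  open NatSolver commutativeSemiring using (solve; _:=_; _:+_; _:*_; con)

  straight unoccupied : HT → ℕ → ℕ → Carrier
  straight   h p j = tileWeight R x y A B h p j hor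
  unoccupied h p j = tileWeight R x y A B h p j blank

  -- The y_j cancel, so the sum is the same in every column, as `rows-commute` requires. For a = b
  -- it is the elbow weight, and the straight weight of one type is the blank weight of the other.
  straight-w+e : ∀ a b j → straight w a j + straight e b j ≈ A + B + (x a - x b)
  straight-w+e a b j = begin
    A + x a - y j + (B - x b + y j)
      ≈⟨ solve 6 (λ A X -Y B -X Y → ((A :+ X) :+ -Y) :+ ((B :+ -X) :+ Y) := (A :+ B :+ (X :+ -X)) :+ (Y :+ -Y)) refl _ _ _ _ _ _ ⟩
    A + B + (x a - x b) + (y j - y j)
      ≈⟨ trans (+-congˡ (-‿inverseʳ (y j))) (+-identityʳ _) ⟩
    A + B + (x a - x b) ∎

  straight-w+e-same : ∀ a j → straight w a j + straight e a j ≈ A + B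
  straight-w+e-same a j = trans (straight-w+e a a j) (trans (+-congˡ (-‿inverseʳ (x a))) (+-identityʳ _))

  straight+unoccupied : ∀ h a j → straight h a j + unoccupied h a j ≈ A + B
  straight+unoccupied w a j = straight-w+e-same a j
  straight+unoccupied e a j = trans (+-comm _ _) (straight-w+e-same a j)

  transfer : ∀ {n} → HT → Fin K → Vec (Colour K) n → Vec (Colour K) n → Carrier
  transfer w k ss ns = Tʷ (straight w (toℕ k)) (suc k) ss ns
  transfer e k ss ns = Tᵉ (straight e (toℕ k)) (suc k) zero ss ns

  Z : ∀ {m n} → Vec HT m → Vec (Fin K) m → Vec (Colour K) n → Carrier
  Z         []      []       ns = δᵛ (blanks _) ns
  Z {n = n} (h ∷ β) (k ∷ ks) ns = ∑ (lines n) (λ ms → Z β ks ms * transfer h k ms ns)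

  -- The labels move together with the types, so each pipe keeps its number and its variable x.
  Z-swap : ∀ {m n} (β : Vec HT m) ks a b (ns : Vec (Colour K) n) →
    Z (w ∷ e ∷ β) (a ∷ b ∷ ks) ns ≈ Z (e ∷ w ∷ β) (b ∷ a ∷ ks) ns
  Z-swap {n = n} β ks a b ns = begin
    Z (w ∷ e ∷ β) (a ∷ b ∷ ks) ns
      ≈⟨ regroup e b w a ⟩
    ∑ (lines n) (λ ss → Z β ks ss * ∑ (lines n) (λ ms → transfer e b ss ms * transfer w a ms ns))
      ≈⟨ ∑-cong (lines n) (λ ss → *-congˡ (sym (rows-commute (straight-w+e (toℕ a) (toℕ b)) a b ss ns))) ⟩
    ∑ (lines n) (λ ss → Z β ks ss * ∑ (lines n) (λ ms → transfer w a ss ms * transfer e b ms ns))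
      ≈⟨ regroup w a e b ⟨
    Z (e ∷ w ∷ β) (b ∷ a ∷ ks) ns ∎
    where
    regroup : ∀ h k h′ k′ → Z (h′ ∷ h ∷ β) (k′ ∷ k ∷ ks) ns ≈
      ∑ (lines n) (λ ss → Z β ks ss * ∑ (lines n) (λ ms → transfer h k ss ms * transfer h′ k′ ms ns))
    regroup h k h′ k′ = begin
      ∑ (lines n) (λ ms → ∑ (lines n) (λ ss → Z β ks ss * transfer h k ss ms) * transfer h′ k′ ms ns)
        ≈⟨ ∑-cong (lines n) (λ ms → trans (∑-* (lines n) _ _) (∑-cong (lines n) (λ ss → *-assoc _ _ _))) ⟩
      ∑ (lines n) (λ ms → ∑ (lines n) (λ ss → Z β ks ss * (transfer h k ss ms * transfer h′ k′ ms ns)))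
        ≈⟨ ∑-swap (lines n) (lines n) _ ⟩
      ∑ (lines n) (λ ss → ∑ (lines n) (λ ms → Z β ks ss * (transfer h k ss ms * transfer h′ k′ ms ns)))
        ≈⟨ ∑-cong (lines n) (λ ss → *-∑ (lines n) _ _) ⟨
      ∑ (lines n) (λ ss → Z β ks ss * ∑ (lines n) (λ ms → transfer h k ss ms * transfer h′ k′ ms ns)) ∎

  Z-bottom : ∀ {n} k (ns : Vec (Colour K) n) → Z (e ∷ []) (k ∷ []) ns ≈ Z (w ∷ []) (k ∷ []) ns
  Z-bottom {n} k ns = begin
    Z (e ∷ []) (k ∷ []) ns   ≈⟨ single e ⟩
    transfer e k (blanks n) ns ≈⟨ bottom-row (straight-w+e-same (toℕ k)) k ns ⟨
    transfer w k (blanks n) ns ≈⟨ single w ⟨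
    Z (w ∷ []) (k ∷ []) ns   ∎
    where
    single : ∀ h → Z (h ∷ []) (k ∷ []) ns ≈ transfer h k (blanks n) ns
    single h = trans (∑-cong (lines n) (λ ms → *-congʳ (δᵛ-sym (blanks n) ms)))
                     (∑-δᵛ (blanks n) (λ ms → transfer h k ms ns))

  allW : ∀ m → Vec HT m
  allW m = Vec.replicate m w

  -- The `e` row carries the greatest label. It passes below each `w` row in turn and changes type
  -- at the bottom, where the greatest label is also the one that a `w` row would get.
  Z-sink : ∀ m {n} (f : Fin (suc m) → Fin K) (ns : Vec (Colour K) n) →
    Z (e ∷ allW m) (f (fromℕ m) ∷ labels (allW m) (f ∘ inject₁)) ns ≈ Z (allW (suc m)) (labels (allW (suc m)) f) ns
  Z-sink zero        f ns = Z-bottom (f zero) ns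
  Z-sink (suc m) {n} f ns = trans
    (sym (Z-swap (allW m) _ (f zero) (f (suc (fromℕ m))) ns))
    (∑-cong (lines n) (λ ms → *-congʳ (Z-sink m (f ∘ suc) ms)))

  Z-allW : ∀ {m n} (β : Vec HT m) (f : Fin m → Fin K) (ns : Vec (Colour K) n) →
    Z β (labels β f) ns ≈ Z (allW m) (labels (allW m) f) ns
  Z-allW []      f ns = refl
  Z-allW {suc m} {n} (w ∷ β) f ns = ∑-cong (lines n) (λ ms → *-congʳ (Z-allW β (f ∘ suc) ms))
  Z-allW {suc m} {n} (e ∷ β) f ns = trans
    (∑-cong (lines n) (λ ms → *-congʳ (Z-allW β (f ∘ inject₁) ms)))
    (Z-sink m f ns)

  gridRowWeight : ∀ {n} → HT → Fin K → Vec Tile n → Carrier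
  gridRowWeight h k = rowWeight (λ j → tileWeight R x y A B h (toℕ k) j)

  gridWeight : ∀ {m n} → Vec HT m → Vec (Fin K) m → Vec (Vec Tile n) m → Carrier
  gridWeight β ks g = ∏ (λ i → gridRowWeight (Vec.lookup β i) (Vec.lookup ks i) (Vec.lookup g i))

  ι-blank : ∀ q → ι (not (isPipe q)) ≈ δ {suc K} q zero
  ι-blank zero    = refl
  ι-blank (suc _) = refl

  rowWeight-cong : ∀ {n f g} → (∀ j t → f j t ≈ g j t) → ∀ (ts : Vec Tile n) → rowWeight f ts ≈ rowWeight g ts
  rowWeight-cong f≈g ts = ∏-cong (λ j → f≈g (toℕ j) (Vec.lookup ts j))

  tileWeight-cell : ∀ h p j t → tileWeight R x y A B h p j t ≈ cellWeight (straight h p j) (unoccupied h p j) t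
  tileWeight-cell h p j blank     = refl
  tileWeight-cell h p j hor       = refl
  tileWeight-cell h p j ver       = refl
  tileWeight-cell h p j cross     = refl
  tileWeight-cell h p j elbowUp   = refl
  tileWeight-cell h p j elbowDown = refl
  tileWeight-cell h p j double    = refl

  transfer-expansion : ∀ {n} h k (ss ns : Vec (Colour K) n) →
    transfer h k ss ns ≈
    ∑ (tileRows n) (λ ts → gridRowWeight h k ts * (ι (rowValid h k ts ss) * δᵛ (rowNorths h k ts ss) ns))
  transfer-expansion {n} w k ss ns = begin
    Tʷ (straight w (toℕ k)) (suc k) ss ns
      ≈⟨ rowʷ-expansion (straight+unoccupied w (toℕ k)) (suc k) ss ns ⟨
    _ ≈⟨ ∑-cong (tileRows n) (λ ts → *-congʳ (sym (rowWeight-cong (tileWeight-cell w (toℕ k)) ts))) ⟩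
    _ ∎
  transfer-expansion {n} e k ss ns = begin
    Tᵉ (straight e (toℕ k)) (suc k) zero ss ns
      ≈⟨ rowᵉ-expansion (straight+unoccupied e (toℕ k)) (suc k) zero ss ns ⟨
    _ ≈⟨ ∑-cong (tileRows n) (λ ts → *-cong (sym (rowWeight-cong (tileWeight-cell e (toℕ k)) ts))
           (*-congʳ (trans (*-congˡ (sym (ι-blank (exitᵉ (suc k) ts ss)))) (sym (ι-∧ (fitsᵉ (suc k) ts ss) _))))) ⟩
    _ ∎

  grids : ∀ m n → List (Vec (Vec Tile n) m)
  grids m n = vecs (tileRows n) m

  -- The tiles of the lower rows determine the line of colours above them, so `δᵛ` collapses the sum
  -- over that line.
  Z-expansion : ∀ {m n} (β : Vec HT m) ks (ns : Vec (Colour K) n) →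
    Z β ks ns ≈ ∑ (grids m n) (λ g → gridWeight β ks g * (ι (valid β ks g) * δᵛ (norths β ks g) ns))
  Z-expansion {n = n} [] [] ns = sym (trans (+-identityʳ _) (trans (*-identityˡ _) (*-identityˡ _)))
  Z-expansion {suc m} {n} (h ∷ β) (k ∷ ks) ns = begin
    ∑ (lines n) (λ ms → Z β ks ms * transfer h k ms ns)
      ≈⟨ ∑-cong (lines n) (λ ms → trans (*-congʳ (Z-expansion β ks ms))
           (trans (∑-* (grids m n) _ _) (∑-cong (grids m n) (λ g →
             solve 4 (λ a b d T → (a :* (b :* d)) :* T := (a :* b) :* (d :* T)) refl _ _ _ _)))) ⟩
    ∑ (lines n) (λ ms → ∑ (grids m n) (λ g →
      (gridWeight β ks g * ι (valid β ks g)) * (δᵛ (norths β ks g) ms * transfer h k ms ns)))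
      ≈⟨ trans (∑-swap (lines n) (grids m n) _) (∑-cong (grids m n) (λ g → trans
           (sym (*-∑ (lines n) _ _)) (*-congˡ (trans
             (∑-cong (lines n) (λ ms → *-congʳ (δᵛ-sym (norths β ks g) ms)))
             (∑-δᵛ (norths β ks g) (λ ms → transfer h k ms ns)))))) ⟩
    ∑ (grids m n) (λ g → (gridWeight β ks g * ι (valid β ks g)) * transfer h k (norths β ks g) ns)
      ≈⟨ ∑-cong (grids m n) (λ g → trans (*-congˡ (transfer-expansion h k (norths β ks g) ns)) (*-∑ (tileRows n) _ _)) ⟩
    ∑ (grids m n) (λ g → ∑ (tileRows n) (λ ts → (gridWeight β ks g * ι (valid β ks g))
      * (gridRowWeight h k ts * (ι (rowValid h k ts (norths β ks g)) * δᵛ (rowNorths h k ts (norths β ks g)) ns))))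
      ≈⟨ ∑-swap (grids m n) (tileRows n) _ ⟩
    ∑ (tileRows n) (λ ts → ∑ (grids m n) (λ g → (gridWeight β ks g * ι (valid β ks g))
      * (gridRowWeight h k ts * (ι (rowValid h k ts (norths β ks g)) * δᵛ (rowNorths h k ts (norths β ks g)) ns))))
      ≈⟨ ∑-cong (tileRows n) (λ ts → ∑-cong (grids m n) (λ g → trans
           (solve 5 (λ a b r v d → (a :* b) :* (r :* (v :* d)) := (r :* a) :* ((v :* b) :* d)) refl _ _ _ _ _)
           (*-congˡ (*-congʳ (sym (ι-∧ (rowValid h k ts (norths β ks g)) _)))))) ⟩
    ∑ (tileRows n) (λ ts → ∑ (grids m n) (λ g → (gridRowWeight h k ts * gridWeight β ks g)
      * (ι (rowValid h k ts (norths β ks g) ∧ valid β ks g) * δᵛ (rowNorths h k ts (norths β ks g)) ns)))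
      ≈⟨ ∑-vecs (tileRows n) m _ ⟨
    _ ∎

  -- Taken at `reads π`, which prescribes the top colours only in the columns of the form `π k`, so
  -- the polynomial is a sum over all accepted top lines.
  Z-contract : ∀ {m n} (β : Vec HT m) ks (p : Vec (Colour K) n → Bool) →
    ∑ (lines n) (λ ns → ι (p ns) * Z β ks ns) ≈
    ∑ (grids m n) (λ g → ι (valid β ks g ∧ p (norths β ks g)) * gridWeight β ks g)
  Z-contract {m} {n} β ks p = begin
    ∑ (lines n) (λ ns → ι (p ns) * Z β ks ns)
      ≈⟨ ∑-cong (lines n) (λ ns → trans (*-congˡ (Z-expansion β ks ns)) (trans (*-∑ (grids m n) _ _)
           (∑-cong (grids m n) (λ g → trans
             (solve 4 (λ p a v d → p :* (a :* (v :* d)) := (a :* v) :* (d :* p)) refl _ _ _ _)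
             (*-congˡ (*-congʳ (δᵛ-sym (norths β ks g) ns))))))) ⟩
    ∑ (lines n) (λ ns → ∑ (grids m n) (λ g →
      (gridWeight β ks g * ι (valid β ks g)) * (δᵛ ns (norths β ks g) * ι (p ns))))
      ≈⟨ ∑-swap (lines n) (grids m n) _ ⟩
    ∑ (grids m n) (λ g → ∑ (lines n) (λ ns →
      (gridWeight β ks g * ι (valid β ks g)) * (δᵛ ns (norths β ks g) * ι (p ns))))
      ≈⟨ ∑-cong (grids m n) (λ g → trans (sym (*-∑ (lines n) _ _)) (*-congˡ (∑-δᵛ (norths β ks g) (ι ∘ p)))) ⟩
    ∑ (grids m n) (λ g → (gridWeight β ks g * ι (valid β ks g)) * ι (p (norths β ks g)))
      ≈⟨ ∑-cong (grids m n) (λ g → trans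
           (solve 3 (λ a v p → (a :* v) :* p := (v :* p) :* a) refl _ _ _)
           (*-congʳ (sym (ι-∧ (valid β ks g) _)))) ⟩
    _ ∎

-- The polynomial as a contraction of the partition function

module GridSum {c ℓ : Level} (R : CommutativeRing c ℓ)
  (x y : ℕ → CommutativeRing.Carrier R) (A B : CommutativeRing.Carrier R) {m n : ℕ} where
  open CommutativeRing R hiding (zero)
  open FiniteSums R
  open RowTransfer R m (A + B)
  open TileExpansion R m (A + B)
  open PartitionFunction R x y A B m
  open import Relation.Binary.Reasoning.Setoid setoid

  ∏-upTo : ∀ {k l} → k ≡ l → ∀ f → foldr _*_ 1# (map f (upTo k)) ≈ ∏ {l} (f ∘ toℕ)
  ∏-upTo {k} ≡.refl f = reflexive (∏-applyUpTo k id f)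

  length-rows : (g : Vec (Vec Tile n) m) → length (rows g) ≡ m
  length-rows g = Vecₚ.length-toList (Vec.map Vec.toList g)

  -- Defs computes the factors of the weight by local functions; these two lemmas make them accessible.
  weight-rows : ∀ β g → Σ[ F ∈ (ℕ → Carrier) ] weight R x y A B β g ≡ foldr _*_ 1# (map F (upTo (length g)))
  weight-rows β g = _ , ≡.refl

  weight-row : ∀ β (g : Vec (Vec Tile n) m) i → Σ[ F ∈ (ℕ → Carrier) ]
    proj₁ (weight-rows β (rows g)) (toℕ i) ≡ foldr _*_ 1# (map F (upTo (length (Vec.toList (Vec.lookup g i)))))
  weight-row β g i rewrite at-rows g i = _ , ≡.refl

  weight-entry : ∀ (β : Vec HT m) (g : Vec (Vec Tile n) m) i j → proj₁ (weight-row (Vec.toList β) g i) (toℕ j) ≈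
    tileWeight R x y A B (Vec.lookup β i) (toℕ (Vec.lookup (labels β id) i)) (toℕ j) (Vec.lookup (Vec.lookup g i) j)
  weight-entry β g i j rewrite lookup-labels β id i | ≡.sym (φ-label β i) | ≡.sym (rowType-toList β i)
    | at-rows g i | at-toList (Vec.lookup g i) j = refl

  weight≈gridWeight : (β : Vec HT m) (g : Vec (Vec Tile n) m) →
    weight R x y A B (Vec.toList β) (rows g) ≈ gridWeight β (labels β id) g
  weight≈gridWeight β g = trans (∏-upTo (length-rows g) _) (∏-cong (λ i → trans
    (reflexive (proj₂ (weight-row (Vec.toList β) g i)))
    (trans (∏-upTo (Vecₚ.length-toList (Vec.lookup g i)) _) (∏-cong (weight-entry β g i)))))

  ∑-allGrids : ∀ f → ∑ (allGrids m n) f ≈ ∑ (vecs (vecs allTiles n) m) (f ∘ rows)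
  ∑-allGrids f = trans (∑-allLists (allLists n allTiles) m f)
    (∑-vecs-reindex (allLists n allTiles) (vecs allTiles n) Vec.toList (∑-allLists allTiles n) m _)

  IsPipeDream : Vec HT m → (Fin m → Fin n) → Grid → Bool
  IsPipeDream β π g = validPD m n (Vec.toList β) g ∧ hasConnectivity m n (Vec.toList β) π g

  -- All combinatorics of tracing pipes enters the computation in the ring through `spec`, which
  -- `isPipeDream≡` supplies.
  module _ (π : Fin m → Fin n) (spec : ∀ β g →
      IsPipeDream β π (rows g) ≡ (valid β (labels {m} β id) g ∧ reads π (norths β (labels β id) g))) where

    G-contraction : ∀ β → G R m n β π x y A B ≈ ∑ (lines n) (λ ns → ι (reads π ns) * Z β (labels β id) ns)
    G-contraction β = begin
      G R m n β π x y A B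
        ≈⟨ reflexive (foldr-map≡∑ (filterᵇ (IsPipeDream β π) (allGrids m n)) _) ⟩
      ∑ (filterᵇ (IsPipeDream β π) (allGrids m n)) (weight R x y A B (Vec.toList β))
        ≈⟨ ∑-filter (IsPipeDream β π) (allGrids m n) _ ⟩
      ∑ (allGrids m n) (λ g → ι (IsPipeDream β π g) * weight R x y A B (Vec.toList β) g)
        ≈⟨ ∑-allGrids _ ⟩
      ∑ (vecs (vecs allTiles n) m) (λ g → ι (IsPipeDream β π (rows g)) * weight R x y A B (Vec.toList β) (rows g))
        ≈⟨ reflexive (cong (λ ts → ∑ (vecs (vecs ts n) m)
             (λ g → ι (IsPipeDream β π (rows g)) * weight R x y A B (Vec.toList β) (rows g))) tiles≡allTiles) ⟨
      ∑ (grids m n) (λ g → ι (IsPipeDream β π (rows g)) * weight R x y A B (Vec.toList β) (rows g))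
        ≈⟨ ∑-cong (grids m n) (λ g → *-cong (reflexive (cong ι (spec β g))) (weight≈gridWeight β g)) ⟩
      ∑ (grids m n) (λ g → ι (valid β (labels β id) g ∧ reads π (norths β (labels β id) g)) * gridWeight β (labels β id) g)
        ≈⟨ Z-contract β (labels β id) (reads π) ⟨
      ∑ (lines n) (λ ns → ι (reads π ns) * Z β (labels β id) ns) ∎

    G-allW : ∀ β → G R m n β π x y A B ≈ ∑ (lines n) (λ ns → ι (reads π ns) * Z (allW m) (labels (allW m) id) ns)
    G-allW β = trans (G-contraction β) (∑-cong (lines n) (λ ns → *-congˡ (Z-allW β id ns)))

-- Following pipes through the grid

open import Data.Nat using (_+_; _*_; _∸_)

-- The vertical edges of a row are numbered 0 to n from the West, cell j lying between edges j and j
-- + 1; colours run up this numbering in a `w` row and down in an `e` row.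
startPos endPos : HT → ℕ → ℕ
startPos w n = 0
startPos e n = n
endPos w n = n
endPos e n = 0

inPos outPos : HT → ℕ → ℕ
inPos  w j = j
inPos  e j = suc j
outPos w j = suc j
outPos e j = j

inSide outSide : HT → Side
inSide  w = W
inSide  e = E
outSide w = E
outSide e = W

==ᵇ⇒≡ : ∀ a b → (a ==ᵇ b) ≡ true → a ≡ b
==ᵇ⇒≡ true  true  _ = ≡.refl
==ᵇ⇒≡ false false _ = ≡.refl

==ᵇ-refl : ∀ a → (a ==ᵇ a) ≡ true
==ᵇ-refl true  = ≡.refl
==ᵇ-refl false = ≡.refl

≡⇒==ᵇ : ∀ {a b} → a ≡ b → (a ==ᵇ b) ≡ true
≡⇒==ᵇ {a} ≡.refl = ==ᵇ-refl a

∧-split : ∀ a {b} → a ∧ b ≡ true → a ≡ true × b ≡ true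
∧-split true b≡true = ≡.refl , b≡true

∧-join : ∀ {a b} → a ≡ true → b ≡ true → a ∧ b ≡ true
∧-join ≡.refl b≡true = b≡true

-- The inductive form of `fits`, matching on which leaves just the admissible combinations.
data Fit {K} : Tile → Colour K → Colour K → Set where
  blank     : Fit blank zero zero
  hor       : ∀ {p} → Fit hor (suc p) zero
  ver       : ∀ {s} → Fit ver zero (suc s)
  cross     : ∀ {p s} → Fit cross (suc p) (suc s)
  elbowUp   : ∀ {p} → Fit elbowUp (suc p) zero
  elbowDown : ∀ {s} → Fit elbowDown zero (suc s)
  double    : ∀ {p s} → Fit double (suc p) (suc s)

fits⇒Fit : ∀ {K} t (p s : Colour K) → fits t p s ≡ true → Fit t p s
fits⇒Fit blank     zero    zero    _ = blank
fits⇒Fit hor       (suc _) zero    _ = hor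
fits⇒Fit ver       zero    (suc _) _ = ver
fits⇒Fit cross     (suc _) (suc _) _ = cross
fits⇒Fit elbowUp   (suc _) zero    _ = elbowUp
fits⇒Fit elbowDown zero    (suc _) _ = elbowDown
fits⇒Fit double    (suc _) (suc _) _ = double

uses-in : ∀ h t → uses h t (inSide h) ≡ uses w t W
uses-in w t         = ≡.refl
uses-in e blank     = ≡.refl
uses-in e hor       = ≡.refl
uses-in e ver       = ≡.refl
uses-in e cross     = ≡.refl
uses-in e elbowUp   = ≡.refl
uses-in e elbowDown = ≡.refl
uses-in e double    = ≡.refl

uses-S : ∀ h t → uses h t S ≡ uses w t S
uses-S w t         = ≡.refl
uses-S e blank     = ≡.refl
uses-S e hor       = ≡.refl
uses-S e ver       = ≡.refl
uses-S e cross     = ≡.refl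
uses-S e elbowUp   = ≡.refl
uses-S e elbowDown = ≡.refl
uses-S e double    = ≡.refl

fits-intro : ∀ {K} h t {p s : Colour K} → uses h t (inSide h) ≡ isPipe p → uses h t S ≡ isPipe s → fits t p s ≡ true
fits-intro h t p s = ∧-join (≡⇒==ᵇ (≡.trans (≡.sym (uses-in h t)) p)) (≡⇒==ᵇ (≡.trans (≡.sym (uses-S h t)) s))

uses-in-isPipe : ∀ {K} h {t} {p s : Colour K} → Fit t p s → uses h t (inSide h) ≡ isPipe p
uses-in-isPipe w blank     = ≡.refl
uses-in-isPipe w hor       = ≡.refl
uses-in-isPipe w ver       = ≡.refl
uses-in-isPipe w cross     = ≡.refl
uses-in-isPipe w elbowUp   = ≡.refl
uses-in-isPipe w elbowDown = ≡.refl
uses-in-isPipe w double    = ≡.refl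
uses-in-isPipe e blank     = ≡.refl
uses-in-isPipe e hor       = ≡.refl
uses-in-isPipe e ver       = ≡.refl
uses-in-isPipe e cross     = ≡.refl
uses-in-isPipe e elbowUp   = ≡.refl
uses-in-isPipe e elbowDown = ≡.refl
uses-in-isPipe e double    = ≡.refl

uses-S-isPipe : ∀ {K} h {t} {p s : Colour K} → Fit t p s → uses h t S ≡ isPipe s
uses-S-isPipe h {t} f = ≡.trans (uses-S h t) (south f)
  where
  south : ∀ {K} {t} {p s : Colour K} → Fit t p s → uses w t S ≡ isPipe s
  south blank     = ≡.refl
  south hor       = ≡.refl
  south ver       = ≡.refl
  south cross     = ≡.refl
  south elbowUp   = ≡.refl
  south elbowDown = ≡.refl
  south double    = ≡.refl

uses-out-isPipe : ∀ {K} h {t} {p s : Colour K} → Fit t p s → uses h t (outSide h) ≡ isPipe (through t p s)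
uses-out-isPipe w blank     = ≡.refl
uses-out-isPipe w hor       = ≡.refl
uses-out-isPipe w ver       = ≡.refl
uses-out-isPipe w cross     = ≡.refl
uses-out-isPipe w elbowUp   = ≡.refl
uses-out-isPipe w elbowDown = ≡.refl
uses-out-isPipe w double    = ≡.refl
uses-out-isPipe e blank     = ≡.refl
uses-out-isPipe e hor       = ≡.refl
uses-out-isPipe e ver       = ≡.refl
uses-out-isPipe e cross     = ≡.refl
uses-out-isPipe e elbowUp   = ≡.refl
uses-out-isPipe e elbowDown = ≡.refl
uses-out-isPipe e double    = ≡.refl

uses-N-isPipe : ∀ {K} h {t} {p s : Colour K} → Fit t p s → uses h t N ≡ isPipe (north t p s)
uses-N-isPipe w blank     = ≡.refl
uses-N-isPipe w hor       = ≡.refl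
uses-N-isPipe w ver       = ≡.refl
uses-N-isPipe w cross     = ≡.refl
uses-N-isPipe w elbowUp   = ≡.refl
uses-N-isPipe w elbowDown = ≡.refl
uses-N-isPipe w double    = ≡.refl
uses-N-isPipe e blank     = ≡.refl
uses-N-isPipe e hor       = ≡.refl
uses-N-isPipe e ver       = ≡.refl
uses-N-isPipe e cross     = ≡.refl
uses-N-isPipe e elbowUp   = ≡.refl
uses-N-isPipe e elbowDown = ≡.refl
uses-N-isPipe e double    = ≡.refl

data Leaves {K} (h : HT) (t : Tile) (s : Side) (a p q : Colour K) : Set where
  upward : connect h t s ≡ just N           → north t p q ≡ a   → Leaves h t s a p q
  onward : connect h t s ≡ just (outSide h) → through t p q ≡ a → Leaves h t s a p q

leaves-in : ∀ {K} h {t} {p : Fin K} {q} → Fit t (suc p) q → Leaves h t (inSide h) (suc p) (suc p) q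
leaves-in w hor     = onward ≡.refl ≡.refl
leaves-in w cross   = onward ≡.refl ≡.refl
leaves-in w elbowUp = upward ≡.refl ≡.refl
leaves-in w double  = upward ≡.refl ≡.refl
leaves-in e hor     = onward ≡.refl ≡.refl
leaves-in e cross   = onward ≡.refl ≡.refl
leaves-in e elbowUp = upward ≡.refl ≡.refl
leaves-in e double  = upward ≡.refl ≡.refl

leaves-S : ∀ {K} h {t} {p} {q : Fin K} → Fit t p (suc q) → Leaves h t S (suc q) p (suc q)
leaves-S w ver       = upward ≡.refl ≡.refl
leaves-S w cross     = upward ≡.refl ≡.refl
leaves-S w elbowDown = onward ≡.refl ≡.refl
leaves-S w double    = onward ≡.refl ≡.refl
leaves-S e ver       = upward ≡.refl ≡.refl
leaves-S e cross     = upward ≡.refl ≡.refl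
leaves-S e elbowDown = onward ≡.refl ≡.refl
leaves-S e double    = onward ≡.refl ≡.refl

rowType-∷ : ∀ h β i → rowType (h ∷ β) (suc i) ≡ rowType β i
rowType-∷ h β i with at β i
... | just _  = ≡.refl
... | nothing = ≡.refl

cell-∷ : ∀ r g i j → cell (r ∷ g) (suc i) j ≡ cell g i j
cell-∷ r g i j with at g i
... | just _  = ≡.refl
... | nothing = ≡.refl

module _ {K : ℕ} where

  atᶜ : ∀ {n} → Vec (Colour K) n → ℕ → Colour K
  atᶜ []       j       = zero
  atᶜ (s ∷ ss) zero    = s
  atᶜ (s ∷ ss) (suc j) = atᶜ ss j

  atᶜ-lookup : ∀ {n} (ss : Vec (Colour K) n) j → atᶜ ss (toℕ j) ≡ Vec.lookup ss j
  atᶜ-lookup (s ∷ ss) zero    = ≡.refl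
  atᶜ-lookup (s ∷ ss) (suc j) = atᶜ-lookup ss j

  atᶜ-replicate : ∀ n j → atᶜ (Vec.replicate n zero) j ≡ zero
  atᶜ-replicate zero    j       = ≡.refl
  atᶜ-replicate (suc n) zero    = ≡.refl
  atᶜ-replicate (suc n) (suc j) = atᶜ-replicate n j

  edgeʷ edgeᵉ : ∀ {n} → Colour K → Vec Tile n → Vec (Colour K) n → ℕ → Colour K
  edgeʷ p ts       ss       zero    = p
  edgeʷ p []       []       (suc j) = zero
  edgeʷ p (t ∷ ts) (s ∷ ss) (suc j) = edgeʷ (through t p s) ts ss j
  edgeᵉ k ts       ss       zero    = exitᵉ k ts ss
  edgeᵉ k []       []       (suc j) = zero
  edgeᵉ k (t ∷ ts) (s ∷ ss) (suc j) = edgeᵉ k ts ss j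

  rowEdge : ∀ {n} → HT → Fin K → Vec Tile n → Vec (Colour K) n → ℕ → Colour K
  rowEdge w k = edgeʷ (suc k)
  rowEdge e k = edgeᵉ (suc k)

  edgeᵉ-end : ∀ {n} k (ts : Vec Tile n) ss → edgeᵉ k ts ss n ≡ k
  edgeᵉ-end k []       []       = ≡.refl
  edgeᵉ-end k (t ∷ ts) (s ∷ ss) = edgeᵉ-end k ts ss

  rowEdge-start : ∀ {n} h k (ts : Vec Tile n) ss → rowEdge h k ts ss (startPos h n) ≡ suc k
  rowEdge-start w k ts ss = ≡.refl
  rowEdge-start e k ts ss = edgeᵉ-end (suc k) ts ss

  RowRule : HT → Tile → (ℕ → Colour K) → (s n : Colour K) → ℕ → Set
  RowRule h t edge s n j =
    n ≡ north t (edge (inPos h j)) s × edge (outPos h j) ≡ through t (edge (inPos h j)) s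

  row-rule : ∀ {n} h k (ts : Vec Tile n) ss j {t} → at (Vec.toList ts) j ≡ just t →
    RowRule h t (rowEdge h k ts ss) (atᶜ ss j) (atᶜ (rowNorths h k ts ss) j) j
  row-rule w k = go (suc k)
    where
    go : ∀ {n} p (ts : Vec Tile n) ss j {t} → at (Vec.toList ts) j ≡ just t →
      RowRule w t (edgeʷ p ts ss) (atᶜ ss j) (atᶜ (northsʷ p ts ss) j) j
    go p (t ∷ ts) (s ∷ ss) zero    ≡.refl = ≡.refl , ≡.refl
    go p (t ∷ ts) (s ∷ ss) (suc j) eq     = go (through t p s) ts ss j eq
  row-rule e k = go
    where
    go : ∀ {n} (ts : Vec Tile n) ss j {t} → at (Vec.toList ts) j ≡ just t →
      RowRule e t (edgeᵉ (suc k) ts ss) (atᶜ ss j) (atᶜ (northsᵉ (suc k) ts ss) j) j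
    go (t ∷ ts) (s ∷ ss) zero    ≡.refl = ≡.refl , ≡.refl
    go (t ∷ ts) (s ∷ ss) (suc j) eq     = go ts ss j eq

  RowFits : ∀ {n} → HT → Fin K → Vec Tile n → Vec (Colour K) n → Set
  RowFits h k ts ss = ∀ j {t} → at (Vec.toList ts) j ≡ just t → fits t (rowEdge h k ts ss (inPos h j)) (atᶜ ss j) ≡ true

  not-isPipe⇒zero : ∀ (p : Colour K) → not (isPipe p) ≡ true → p ≡ zero
  not-isPipe⇒zero zero _ = ≡.refl

  rowValid⇒ : ∀ {n} h k (ts : Vec Tile n) ss → rowValid h k ts ss ≡ true →
    RowFits h k ts ss × rowEdge h k ts ss (endPos h n) ≡ zero
  rowValid⇒ w k ts ss v = fit (suc k) ts ss v , end (suc k) ts ss v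
    where
    fit : ∀ {n} p (ts : Vec Tile n) ss → validʷ p ts ss ≡ true → ∀ j {t} → at (Vec.toList ts) j ≡ just t →
      fits t (edgeʷ p ts ss j) (atᶜ ss j) ≡ true
    fit p (t ∷ ts) (s ∷ ss) v zero    ≡.refl = proj₁ (∧-split (fits t p s) v)
    fit p (t ∷ ts) (s ∷ ss) v (suc j) eq     = fit (through t p s) ts ss (proj₂ (∧-split (fits t p s) v)) j eq
    end : ∀ {n} p (ts : Vec Tile n) ss → validʷ p ts ss ≡ true → edgeʷ p ts ss n ≡ zero
    end p []       []       v = not-isPipe⇒zero p v
    end p (t ∷ ts) (s ∷ ss) v = end (through t p s) ts ss (proj₂ (∧-split (fits t p s) v))
  rowValid⇒ e k ts ss v =
    fit ts ss (proj₁ (∧-split (fitsᵉ (suc k) ts ss) v)) , not-isPipe⇒zero _ (proj₂ (∧-split (fitsᵉ (suc k) ts ss) v))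
    where
    fit : ∀ {n} (ts : Vec Tile n) ss → fitsᵉ (suc k) ts ss ≡ true → ∀ j {t} → at (Vec.toList ts) j ≡ just t →
      fits t (edgeᵉ (suc k) ts ss (suc j)) (atᶜ ss j) ≡ true
    fit (t ∷ ts) (s ∷ ss) v zero    ≡.refl = proj₁ (∧-split (fits t _ s) v)
    fit (t ∷ ts) (s ∷ ss) v (suc j) eq     = fit ts ss (proj₂ (∧-split (fits t _ s) v)) j eq

  rowValid⇐ : ∀ {n} h k (ts : Vec Tile n) ss →
    RowFits h k ts ss → rowEdge h k ts ss (endPos h n) ≡ zero → rowValid h k ts ss ≡ true
  rowValid⇐ w k = go (suc k)
    where
    go : ∀ {n} p (ts : Vec Tile n) ss →
      (∀ j {t} → at (Vec.toList ts) j ≡ just t → fits t (edgeʷ p ts ss j) (atᶜ ss j) ≡ true) →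
      edgeʷ p ts ss n ≡ zero → validʷ p ts ss ≡ true
    go p []       []       f ≡.refl = ≡.refl
    go p (t ∷ ts) (s ∷ ss) f end    = ∧-join (f 0 ≡.refl) (go (through t p s) ts ss (f ∘ suc) end)
  rowValid⇐ e k ts ss f end = ∧-join (go ts ss f) (cong (not ∘ isPipe) end)
    where
    go : ∀ {n} (ts : Vec Tile n) ss →
      (∀ j {t} → at (Vec.toList ts) j ≡ just t → fits t (edgeᵉ (suc k) ts ss (suc j)) (atᶜ ss j) ≡ true) →
      fitsᵉ (suc k) ts ss ≡ true
    go []       []       f = ≡.refl
    go (t ∷ ts) (s ∷ ss) f = ∧-join (f 0 ≡.refl) (go ts ss (f ∘ suc))

  -- Colour of the North edge of cell (i , j), and of its West edge; row m and column n
  -- stand for the South and East boundaries.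
  northAt westAt : ∀ {m n} → Vec HT m → Vec (Fin K) m → Vec (Vec Tile n) m → ℕ → ℕ → Colour K
  northAt []      []       []       i       j = zero
  northAt (h ∷ β) (k ∷ ks) (ts ∷ g) zero    j = atᶜ (rowNorths h k ts (norths β ks g)) j
  northAt (h ∷ β) (k ∷ ks) (ts ∷ g) (suc i) j = northAt β ks g i j
  westAt []      []       []       i       j = zero
  westAt (h ∷ β) (k ∷ ks) (ts ∷ g) zero    j = rowEdge h k ts (norths β ks g) j
  westAt (h ∷ β) (k ∷ ks) (ts ∷ g) (suc i) j = westAt β ks g i j

  northAt-top : ∀ {m n} β ks (g : Vec (Vec Tile n) m) j → northAt β ks g 0 j ≡ atᶜ (norths β ks g) j
  northAt-top {n = n} [] [] [] j = ≡.sym (atᶜ-replicate n j)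
  northAt-top (h ∷ β) (k ∷ ks) (ts ∷ g) j = ≡.refl

  northAt-bottom : ∀ {m n} β ks (g : Vec (Vec Tile n) m) j → northAt β ks g m j ≡ zero
  northAt-bottom []      []       []       j = ≡.refl
  northAt-bottom (h ∷ β) (k ∷ ks) (ts ∷ g) j = northAt-bottom β ks g j

  westAt-start : ∀ {m n} (β : Vec HT m) ks (g : Vec (Vec Tile n) m) i →
    westAt β ks g (toℕ i) (startPos (rowType (Vec.toList β) (toℕ i)) n) ≡ suc (Vec.lookup ks i)
  westAt-start (h ∷ β) (k ∷ ks) (ts ∷ g) zero = rowEdge-start h k ts (norths β ks g)
  westAt-start (h ∷ β) (k ∷ ks) (ts ∷ g) (suc i) rewrite rowType-∷ h (Vec.toList β) (toℕ i) = westAt-start β ks g i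

  grid-rule : ∀ {m n} β ks (g : Vec (Vec Tile n) m) i j {t} → cell (rows g) i j ≡ just t →
    RowRule (rowType (Vec.toList β) i) t (westAt β ks g i) (northAt β ks g (suc i) j) (northAt β ks g i j) j
  grid-rule (h ∷ β) (k ∷ ks) (ts ∷ g) zero j eq
    rewrite northAt-top β ks g j = row-rule h k ts (norths β ks g) j eq
  grid-rule (h ∷ β) (k ∷ ks) (ts ∷ g) (suc i) j eq
    rewrite rowType-∷ h (Vec.toList β) i = grid-rule β ks g i j (≡.trans (≡.sym (cell-∷ (Vec.toList ts) (rows g) i j)) eq)

  Fits : ∀ {m n} → Vec HT m → Vec (Fin K) m → Vec (Vec Tile n) m → Set
  Fits β ks g = ∀ i j {t} → cell (rows g) i j ≡ just t →
    fits t (westAt β ks g i (inPos (rowType (Vec.toList β) i) j)) (northAt β ks g (suc i) j) ≡ true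

  Ends : ∀ {m n} → Vec HT m → Vec (Fin K) m → Vec (Vec Tile n) m → Set
  Ends {m} {n} β ks g = ∀ i → i < m → westAt β ks g i (endPos (rowType (Vec.toList β) i) n) ≡ zero

  valid⇒ : ∀ {m n} β ks (g : Vec (Vec Tile n) m) → valid β ks g ≡ true → Fits β ks g × Ends β ks g
  valid⇒ {n = n} [] [] [] v = (λ i j ()) , λ i ()
  valid⇒ {suc m} {n} (h ∷ β) (k ∷ ks) (ts ∷ g) v = fit , end
    where
    top = rowValid⇒ h k ts (norths β ks g) (proj₁ (∧-split (rowValid h k ts (norths β ks g)) v))
    rest = valid⇒ β ks g (proj₂ (∧-split (rowValid h k ts (norths β ks g)) v))
    fit : Fits (h ∷ β) (k ∷ ks) (ts ∷ g)
    fit zero    j eq rewrite northAt-top β ks g j = proj₁ top j eq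
    fit (suc i) j eq rewrite rowType-∷ h (Vec.toList β) i =
      proj₁ rest i j (≡.trans (≡.sym (cell-∷ (Vec.toList ts) (rows g) i j)) eq)
    end : Ends (h ∷ β) (k ∷ ks) (ts ∷ g)
    end zero    i<m = proj₂ top
    end (suc i) (s≤s i<m) rewrite rowType-∷ h (Vec.toList β) i = proj₂ rest i i<m

  valid⇐ : ∀ {m n} β ks (g : Vec (Vec Tile n) m) → Fits β ks g → Ends β ks g → valid β ks g ≡ true
  valid⇐ []      []       []       fit end = ≡.refl
  valid⇐ {suc m} {n} (h ∷ β) (k ∷ ks) (ts ∷ g) fit end = ∧-join
    (rowValid⇐ h k ts (norths β ks g) topFits (end 0 (s≤s z≤n)))
    (valid⇐ β ks g restFits restEnds)
    where
    topFits : RowFits h k ts (norths β ks g)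
    topFits j eq with fit 0 j eq
    ... | f rewrite northAt-top β ks g j = f
    restFits : Fits β ks g
    restFits i j eq with fit (suc i) j (≡.trans (cell-∷ (Vec.toList ts) (rows g) i j) eq)
    ... | f rewrite rowType-∷ h (Vec.toList β) i = f
    restEnds : Ends β ks g
    restEnds i i<m with end (suc i) (s≤s i<m)
    ... | f rewrite rowType-∷ h (Vec.toList β) i = f

-- Local conditions of a pipe dream in terms of colours

at-exists : ∀ {X : Set} {n} (v : Vec X n) j → j < n → ∃[ t ] at (Vec.toList v) j ≡ just t
at-exists (a ∷ v) zero    j<n       = a , ≡.refl
at-exists (a ∷ v) (suc j) (s≤s j<n) = at-exists v j j<n

at-bound : ∀ {X : Set} {n} (v : Vec X n) j {t} → at (Vec.toList v) j ≡ just t → j < n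
at-bound (a ∷ v) zero    eq = s≤s z≤n
at-bound (a ∷ v) (suc j) eq = s≤s (at-bound v j eq)

cell-exists : ∀ {m n} (g : Vec (Vec Tile n) m) i j → i < m → j < n → ∃[ t ] cell (rows g) i j ≡ just t
cell-exists (ts ∷ g) zero    j i<m       j<n = at-exists ts j j<n
cell-exists (ts ∷ g) (suc i) j (s≤s i<m) j<n rewrite cell-∷ (Vec.toList ts) (rows g) i j = cell-exists g i j i<m j<n

cell-bound : ∀ {m n} (g : Vec (Vec Tile n) m) i j {t} → cell (rows g) i j ≡ just t → i < m × j < n
cell-bound (ts ∷ g) zero    j eq = s≤s z≤n , at-bound ts j eq
cell-bound (ts ∷ g) (suc i) j eq rewrite cell-∷ (Vec.toList ts) (rows g) i j with cell-bound g i j eq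
... | i<m , j<n = s≤s i<m , j<n

cell-outside : ∀ {m n} (g : Vec (Vec Tile n) m) i j → ¬ (i < m × j < n) → cell (rows g) i j ≡ nothing
cell-outside g i j out with cell (rows g) i j in eq
... | nothing = ≡.refl
... | just t  = contradiction (cell-bound g i j eq) out

allᵇ-applyUpTo⇒ : ∀ {X : Set} (f : X → Bool) (g : ℕ → X) k → allᵇ f (applyUpTo g k) ≡ true → ∀ {i} → i < k → f (g i) ≡ true
allᵇ-applyUpTo⇒ f g (suc k) all {zero}  _         = proj₁ (∧-split (f (g 0)) all)
allᵇ-applyUpTo⇒ f g (suc k) all {suc i} (s≤s i<k) = allᵇ-applyUpTo⇒ f (g ∘ suc) k (proj₂ (∧-split (f (g 0)) all)) i<k

allᵇ-applyUpTo⇐ : ∀ {X : Set} (f : X → Bool) (g : ℕ → X) k → (∀ {i} → i < k → f (g i) ≡ true) → allᵇ f (applyUpTo g k) ≡ true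
allᵇ-applyUpTo⇐ f g zero    all = ≡.refl
allᵇ-applyUpTo⇐ f g (suc k) all = ∧-join (all (s≤s z≤n)) (allᵇ-applyUpTo⇐ f (g ∘ suc) k (all ∘ s≤s))

-- Defs computes the condition at a cell by a local function; this lemma makes it accessible.
validPD-cells : ∀ m n β g → Σ[ F ∈ (ℕ → ℕ → Bool) ] validPD m n β g ≡ allᵇ (λ i → allᵇ (F i) (upTo n)) (upTo m)
validPD-cells m n β g = _ , ≡.refl

validPD-cell : ∀ m n β g {i j t} → cell g i j ≡ just t →
  proj₁ (validPD-cells m n β g) i j ≡ allᵇ (sideOK β g i j t) allSides
validPD-cell m n β g eq rewrite eq = ≡.refl

SidesOK : List HT → Grid → Set
SidesOK β g = ∀ i j {t} → cell g i j ≡ just t → ∀ s → sideOK β g i j t s ≡ true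

validPD⇒ : ∀ {m n} (β : Vec HT m) (g : Vec (Vec Tile n) m) → validPD m n (Vec.toList β) (rows g) ≡ true → SidesOK (Vec.toList β) (rows g)
validPD⇒ {m} {n} β g v i j {t} eq = sides
  where
  here : allᵇ (sideOK (Vec.toList β) (rows g) i j t) allSides ≡ true
  here = ≡.trans (≡.sym (validPD-cell m n (Vec.toList β) (rows g) eq))
    (allᵇ-applyUpTo⇒ _ id n (allᵇ-applyUpTo⇒ _ id m v (proj₁ (cell-bound g i j eq))) (proj₂ (cell-bound g i j eq)))
  sides : ∀ s → sideOK (Vec.toList β) (rows g) i j t s ≡ true
  sides s with ∧-split (sideOK (Vec.toList β) (rows g) i j t N) here
  ... | n , here₁ with ∧-split (sideOK (Vec.toList β) (rows g) i j t S) here₁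
  ... | s′ , here₂ with ∧-split (sideOK (Vec.toList β) (rows g) i j t E) here₂
  ... | e′ , here₃ with s
  ... | N = n
  ... | S = s′
  ... | E = e′
  ... | W = proj₁ (∧-split (sideOK (Vec.toList β) (rows g) i j t W) here₃)

validPD⇐ : ∀ {m n} (β : Vec HT m) (g : Vec (Vec Tile n) m) → SidesOK (Vec.toList β) (rows g) → validPD m n (Vec.toList β) (rows g) ≡ true
validPD⇐ {m} {n} β g ok = allᵇ-applyUpTo⇐ _ id m λ {i} i<m → allᵇ-applyUpTo⇐ _ id n λ {j} j<n →
  let t , eq = cell-exists g i j i<m j<n in
  ≡.trans (validPD-cell m n (Vec.toList β) (rows g) eq)
    (∧-join (ok i j eq N) (∧-join (ok i j eq S) (∧-join (ok i j eq E) (∧-join (ok i j eq W) ≡.refl))))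

sideOK-interior : ∀ β g {i j t s i′ j′ t′} → step s (i , j) ≡ just (i′ , j′) → cell g i′ j′ ≡ just t′ →
  sideOK β g i j t s ≡ (uses (rowType β i) t s ==ᵇ uses (rowType β i′) t′ (opp s))
sideOK-interior β g st eq rewrite st | eq = ≡.refl

sideOK-south : ∀ β g {i j t} → cell g (suc i) j ≡ nothing → sideOK β g i j t S ≡ not (uses (rowType β i) t S)
sideOK-south β g eq rewrite eq = ≡.refl

sideOK-east : ∀ β g {i j t} → cell g i (suc j) ≡ nothing →
  sideOK β g i j t E ≡ (uses (rowType β i) t E ==ᵇ (rowType β i ==ʰ e))
sideOK-east β g eq rewrite eq = ≡.refl

not-true : ∀ {b} → not b ≡ true → b ≡ false
not-true {false} _ = ≡.refl

isPipe-false : ∀ {K} {p : Colour K} → isPipe p ≡ false → p ≡ zero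
isPipe-false {p = zero} _ = ≡.refl

module _ {K m n : ℕ} (β : Vec HT m) (ks : Vec (Fin K) m) (g : Vec (Vec Tile n) m) where

  private
    type : ℕ → HT
    type = rowType (Vec.toList β)
    tile : ℕ → ℕ → Maybe Tile
    tile = cell (rows g)
    north′ west′ : ℕ → ℕ → Colour K
    north′ = northAt β ks g
    west′  = westAt β ks g

  colourAt : ℕ → ℕ → Side → Colour K
  colourAt i j N = north′ i j
  colourAt i j S = north′ (suc i) j
  colourAt i j W = west′ i j
  colourAt i j E = west′ i (suc j)

  CellFits : ℕ → ℕ → Tile → Set
  CellFits i j t = fits t (west′ i (inPos (type i) j)) (north′ (suc i) j) ≡ true

  CellFits⇒Fit : ∀ {i j t} → CellFits i j t → Fit t (west′ i (inPos (type i) j)) (north′ (suc i) j)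
  CellFits⇒Fit = fits⇒Fit _ _ _

  colourAt-in : ∀ h i j → colourAt i j (inSide h) ≡ west′ i (inPos h j)
  colourAt-in w i j = ≡.refl
  colourAt-in e i j = ≡.refl

  colourAt-out : ∀ h i j → colourAt i j (outSide h) ≡ west′ i (outPos h j)
  colourAt-out w i j = ≡.refl
  colourAt-out e i j = ≡.refl

  -- Sides sorted by their role in the row, which treats both row types at once.
  data InOut (h : HT) : Side → Set where
    up : InOut h N
    down : InOut h S
    in′   : InOut h (inSide h)
    out   : InOut h (outSide h)

  inOut : ∀ h s → InOut h s
  inOut h N = up
  inOut h S = down
  inOut w W = in′
  inOut w E = out
  inOut e W = out
  inOut e E = in′

  uses-colourAt : ∀ i j {t} → tile i j ≡ just t → CellFits i j t → ∀ s → uses (type i) t s ≡ isPipe (colourAt i j s)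
  uses-colourAt i j {t} eq f s with grid-rule β ks g i j eq | inOut (type i) s
  ... | n≡ , out≡ | up = ≡.trans (uses-N-isPipe (type i) (CellFits⇒Fit f)) (cong isPipe (≡.sym n≡))
  ... | n≡ , out≡ | down = uses-S-isPipe (type i) (CellFits⇒Fit f)
  ... | n≡ , out≡ | in′   = ≡.trans (uses-in-isPipe (type i) (CellFits⇒Fit f)) (cong isPipe (≡.sym (colourAt-in (type i) i j)))
  ... | n≡ , out≡ | out   = ≡.trans (uses-out-isPipe (type i) (CellFits⇒Fit f))
    (cong isPipe (≡.sym (≡.trans (colourAt-out (type i) i j) out≡)))

  west-start : ∀ i → i < m → ∃[ k ] west′ i (startPos (type i) n) ≡ suc k
  west-start i i<m with westAt-start β ks g (fromℕ< i<m)
  ... | eq rewrite Finₚ.toℕ-fromℕ< i<m = _ , eq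

  module _ (ok : SidesOK (Vec.toList β) (rows g)) where

    interior : ∀ s i j i′ j′ {t t′} → step s (i , j) ≡ just (i′ , j′) → tile i j ≡ just t → tile i′ j′ ≡ just t′ →
      uses (type i) t s ≡ uses (type i′) t′ (opp s)
    interior s i j i′ j′ st eq eq′ =
      ==ᵇ⇒≡ _ _ (≡.trans (≡.sym (sideOK-interior (Vec.toList β) (rows g) st eq′)) (ok i j eq s))

    -- Induction along the row from the boundary where its pipe enters: a cell that fits decides
    -- whether its outgoing edge is used, and the interior condition hands this to the next cell.
    fits-from-south : ∀ i → i < m →
      (∀ j {t} → tile i j ≡ just t → uses (type i) t S ≡ isPipe (north′ (suc i) j)) →
      ∀ j {t} → tile i j ≡ just t → CellFits i j t
    fits-from-south i i<m south j {t} eq with type i in ty | west-start i i<m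
    ... | w | k , start = go j eq
      where
      go : ∀ j {t} → tile i j ≡ just t → fits t (west′ i j) (north′ (suc i) j) ≡ true
      west : ∀ j {t} → tile i j ≡ just t → uses w t W ≡ isPipe (west′ i j)
      go j eq = fits-intro w _ (west j eq) (south j eq)
      west zero {t} eq = ≡.trans (==ᵇ⇒≡ _ _ (boundary {t} (ok i 0 eq W))) (cong isPipe (≡.sym start))
        where
        boundary : ∀ {t} → sideOK (Vec.toList β) (rows g) i 0 t W ≡ true → (uses w t W ==ᵇ true) ≡ true
        boundary o rewrite ty = o
      west (suc j) {t} eq with cell-exists g i j i<m (ℕₚ.<-trans (ℕₚ.n<1+n j) (proj₂ (cell-bound g i (suc j) eq)))
      ... | t′ , eq′ with interior W i (suc j) i j ≡.refl eq eq′ | grid-rule β ks g i j eq′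
      ... | same | _ , out≡ rewrite ty = ≡.trans same
        (≡.trans (uses-out-isPipe w (fits⇒Fit t′ _ _ (go j eq′))) (cong isPipe (≡.sym out≡)))
    -- The counter n - (j + 1) is the number of cells between column j and the East boundary.
    ... | e | k , start = go (n ∸ suc j) j (ℕₚ.m∸n+n≡m (proj₂ (cell-bound g i j eq))) eq
      where
      go : ∀ d j {t} → d + suc j ≡ n → tile i j ≡ just t → fits t (west′ i (suc j)) (north′ (suc i) j) ≡ true
      east : ∀ d j {t} → d + suc j ≡ n → tile i j ≡ just t → uses e t E ≡ isPipe (west′ i (suc j))
      go d j d≡ eq = fits-intro e _ (east d j d≡ eq) (south j eq)
      east zero j {t} ≡.refl eq = ≡.trans (==ᵇ⇒≡ _ _ boundary) (cong isPipe (≡.sym start))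
        where
        boundary : (uses e t E ==ᵇ true) ≡ true
        boundary with ≡.trans (≡.sym (sideOK-east (Vec.toList β) (rows g) {t = t}
          (cell-outside g i (suc j) (λ (_ , b) → ℕₚ.n≮n _ b)))) (ok i j eq E)
        ... | o rewrite ty = o
      east (suc d) j {t} d≡ eq with cell-exists g i (suc j) i<m (≡.subst (suc j <_) d≡ (s≤s (ℕₚ.m≤n+m (suc j) d)))
      ... | t′ , eq′ with interior E i j i (suc j) ≡.refl eq eq′ | grid-rule β ks g i (suc j) eq′
      ... | same | _ , out≡ rewrite ty = ≡.trans same
        (≡.trans (uses-out-isPipe e (fits⇒Fit t′ _ _ (go d (suc j) (≡.trans (ℕₚ.+-suc d (suc j)) d≡) eq′))) (cong isPipe (≡.sym out≡)))

    -- Induction from the bottom row upwards: the South boundary is blank, and a row whose cells fit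
    -- decides which South edges of the row above are used.
    sidesOK⇒Fits : Fits β ks g
    sidesOK⇒Fits i j eq = go (m ∸ suc i) i (ℕₚ.m∸n+n≡m (proj₁ (cell-bound g i j eq))) j eq
      where
      go : ∀ d i → d + suc i ≡ m → ∀ j {t} → tile i j ≡ just t → CellFits i j t
      south : ∀ d i → d + suc i ≡ m → ∀ j {t} → tile i j ≡ just t → uses (type i) t S ≡ isPipe (north′ (suc i) j)
      go d i d≡ j eq = fits-from-south i (proj₁ (cell-bound g i j eq)) (south d i d≡) j eq
      south zero i ≡.refl j {t} eq = ≡.trans
        (not-true (≡.trans (≡.sym (sideOK-south (Vec.toList β) (rows g) {t = t}
          (cell-outside g (suc i) j (λ (b , _) → ℕₚ.n≮n _ b)))) (ok i j eq S)))
        (cong isPipe (≡.sym (northAt-bottom β ks g j)))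
      south (suc d) i d≡ j eq
        with cell-exists g (suc i) j (≡.subst (suc i <_) d≡ (s≤s (ℕₚ.m≤n+m (suc i) d))) (proj₂ (cell-bound g i j eq))
      ... | t′ , eq′ = ≡.trans (interior S i j (suc i) j ≡.refl eq eq′)
        (uses-colourAt (suc i) j eq′ (go d (suc i) (≡.trans (ℕₚ.+-suc d (suc i)) d≡) j eq′) N)

    -- The condition at the exit boundary is read in the last cell of the row; `1 ≤ n` provides this
    -- cell.
    sidesOK⇒Ends : 1 ≤ n → Ends β ks g
    sidesOK⇒Ends (s≤s {n = l} z≤n) i i<m with type i in ty
    ... | w with cell-exists g i l i<m (ℕₚ.n<1+n l)
    ...   | t , eq = isPipe-false (≡.trans (≡.sym (uses-colourAt i l eq (sidesOK⇒Fits i l eq) E)) boundary)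
      where
      boundary : uses (type i) t E ≡ false
      boundary with ≡.trans (≡.sym (sideOK-east (Vec.toList β) (rows g) {t = t}
          (cell-outside g i (suc l) (λ (_ , b) → ℕₚ.n≮n _ b)))) (ok i l eq E)
      ... | o rewrite ty = ==ᵇ⇒≡ _ _ o
    sidesOK⇒Ends (s≤s {n = l} z≤n) i i<m | e with cell-exists g i 0 i<m (s≤s z≤n)
    ...   | t , eq = isPipe-false (≡.trans (≡.sym (uses-colourAt i 0 eq (sidesOK⇒Fits i 0 eq) W)) (boundary (ok i 0 eq W)))
      where
      boundary : sideOK (Vec.toList β) (rows g) i 0 t W ≡ true → uses (type i) t W ≡ false
      boundary o rewrite ty = ==ᵇ⇒≡ _ _ o

  module _ (fit : Fits β ks g) (end : Ends β ks g) where

    colour-uses : ∀ i j {t} → tile i j ≡ just t → ∀ s → uses (type i) t s ≡ isPipe (colourAt i j s)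
    colour-uses i j eq = uses-colourAt i j eq (fit i j eq)

    interiorOK : ∀ s i j i′ j′ {t} → step s (i , j) ≡ just (i′ , j′) → tile i j ≡ just t → i′ < m → j′ < n →
      colourAt i j s ≡ colourAt i′ j′ (opp s) → sideOK (Vec.toList β) (rows g) i j t s ≡ true
    interiorOK s i j i′ j′ st eq i′<m j′<n same with cell-exists g i′ j′ i′<m j′<n
    ... | t′ , eq′ = ≡.trans (sideOK-interior (Vec.toList β) (rows g) st eq′)
      (≡⇒==ᵇ (≡.trans (colour-uses i j eq s) (≡.trans (cong isPipe same) (≡.sym (colour-uses i′ j′ eq′ (opp s))))))

    -- Neighbouring cells read their common edge from the same entry of `northAt` or `westAt`, so
    -- agreement in the interior is `refl`. At the boundary the colours are known from `Ends`,
    -- `west-start` and `northAt-bottom`.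
    Fits⇒sidesOK : SidesOK (Vec.toList β) (rows g)
    Fits⇒sidesOK zero    j eq N = ≡.refl
    Fits⇒sidesOK (suc i) j eq N = interiorOK N (suc i) j i j ≡.refl eq
      (ℕₚ.<-trans (ℕₚ.n<1+n i) (proj₁ (cell-bound g (suc i) j eq))) (proj₂ (cell-bound g (suc i) j eq)) ≡.refl
    Fits⇒sidesOK i j eq S with ℕₚ._<?_ (suc i) m
    ... | yes si<m = interiorOK S i j (suc i) j ≡.refl eq si<m (proj₂ (cell-bound g i j eq)) ≡.refl
    ... | no  si≮m = ≡.trans (sideOK-south (Vec.toList β) (rows g) (cell-outside g (suc i) j (si≮m ∘ proj₁)))
      (cong not (≡.trans (colour-uses i j eq S) (cong isPipe bottom)))
      where
      bottom : north′ (suc i) j ≡ zero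
      bottom rewrite ℕₚ.≤-antisym (proj₁ (cell-bound g i j eq)) (ℕₚ.≮⇒≥ si≮m) = northAt-bottom β ks g j
    Fits⇒sidesOK i j {t} eq E with ℕₚ._<?_ (suc j) n
    ... | yes sj<n = interiorOK E i j i (suc j) ≡.refl eq (proj₁ (cell-bound g i j eq)) sj<n ≡.refl
    ... | no  sj≮n = ≡.trans (sideOK-east (Vec.toList β) (rows g) (cell-outside g i (suc j) (sj≮n ∘ proj₂)))
      (≡⇒==ᵇ (≡.trans (colour-uses i j eq E) boundary))
      where
      i<m = proj₁ (cell-bound g i j eq)
      boundary : isPipe (west′ i (suc j)) ≡ (type i ==ʰ e)
      boundary rewrite ℕₚ.≤-antisym (proj₂ (cell-bound g i j eq)) (ℕₚ.≮⇒≥ sj≮n)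
        with type i | end i i<m | west-start i i<m
      ... | w | east  | _ = cong isPipe east
      ... | e | _     | _ , east = cong isPipe east
    Fits⇒sidesOK i (suc j) eq W = interiorOK W i (suc j) i j ≡.refl eq
      (proj₁ (cell-bound g i (suc j) eq)) (ℕₚ.<-trans (ℕₚ.n<1+n j) (proj₂ (cell-bound g i (suc j) eq))) ≡.refl
    Fits⇒sidesOK i zero {t} eq W = ≡⇒==ᵇ (≡.trans (colour-uses i 0 eq W) boundary)
      where
      i<m = proj₁ (cell-bound g i 0 eq)
      boundary : isPipe (west′ i 0) ≡ (type i ==ʰ w)
      boundary with type i | end i i<m | west-start i i<m
      ... | w | _    | _ , west = cong isPipe west
      ... | e | west | _ = cong isPipe west

-- Single steps of the tracing and a measure for its length

follow-exit : ∀ f β g {j t s} → cell g 0 j ≡ just t → connect (rowType β 0) t s ≡ just N →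
  follow (suc f) β g 0 j s ≡ just j
follow-exit f β g eq to rewrite eq | to = ≡.refl

follow-north : ∀ f β g {i j t s t′} → cell g (suc i) j ≡ just t → connect (rowType β (suc i)) t s ≡ just N →
  cell g i j ≡ just t′ → follow (suc f) β g (suc i) j s ≡ follow f β g i j S
follow-north f β g eq to eq′ rewrite eq | to | eq′ = ≡.refl

follow-east : ∀ f β g {i j t s t′} → cell g i j ≡ just t → connect (rowType β i) t s ≡ just E →
  cell g i (suc j) ≡ just t′ → follow (suc f) β g i j s ≡ follow f β g i (suc j) W
follow-east f β g eq to eq′ rewrite eq | to | eq′ = ≡.refl

follow-west : ∀ f β g {i j t s t′} → cell g i (suc j) ≡ just t → connect (rowType β i) t s ≡ just W →
  cell g i j ≡ just t′ → follow (suc f) β g i (suc j) s ≡ follow f β g i j E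
follow-west f β g eq to eq′ rewrite eq | to | eq′ = ≡.refl

-- Number of cells a pipe can still visit: it never moves down, nor against the direction of its row.
remaining : HT → (n i j : ℕ) → ℕ
remaining w n i j = i * n + (n ∸ j)
remaining e n i j = i * n + suc j

-- Together with `remaining≤`: the number (i + 1) n bounds the measure throughout row i and lies
-- strictly below it in row i + 1, so a turn to the North decreases it.
remaining> : ∀ h {n j} i → j < n → i * n < remaining h n i j
remaining> w i j<n = ℕₚ.m<m+n (i * _) (ℕₚ.m<n⇒0<n∸m j<n)
remaining> e i j<n = ℕₚ.m<m+n (i * _) (s≤s z≤n)

remaining≤ : ∀ h {n j} i → j < n → remaining h n i j ≤ suc i * n
remaining≤ w {n} {j} i j<n = ≡.subst (_≤ n + i * n) (ℕₚ.+-comm (n ∸ j) (i * n)) (ℕₚ.+-monoˡ-≤ (i * n) (ℕₚ.m∸n≤m n j))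
remaining≤ e {n} {j} i j<n = ≡.subst (_≤ n + i * n) (ℕₚ.+-comm (suc j) (i * n)) (ℕₚ.+-monoˡ-≤ (i * n) j<n)

-- Conservation of colours

bit : Bool → ℕ
bit b = if b then 1 else 0

occurrences : ∀ {K n} → Fin K → Vec (Fin K) n → ℕ
occurrences c []       = 0
occurrences c (a ∷ as) = bit (does (a ≟ c)) + occurrences c as

does-≟-refl : ∀ {K} (c : Fin K) → does (c ≟ c) ≡ true
does-≟-refl c = dec-true (c ≟ c) ≡.refl

does-≟⇒≡ : ∀ {K} (a b : Fin K) → does (a ≟ b) ≡ true → a ≡ b
does-≟⇒≡ a b eq with a ≟ b
... | yes a≡b = a≡b

occurrences-∷ : ∀ {K n} c (as : Vec (Fin K) n) → occurrences c (c ∷ as) ≡ suc (occurrences c as)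
occurrences-∷ c as rewrite does-≟-refl c = ≡.refl

atᶜ-occurs : ∀ {K n} (ss : Vec (Colour K) n) c j → atᶜ ss j ≡ suc c → 1 ≤ occurrences (suc c) ss
atᶜ-occurs (s ∷ ss) c zero ≡.refl = ≡.subst (1 ≤_) (≡.sym (occurrences-∷ (suc c) ss)) (s≤s z≤n)
atᶜ-occurs (s ∷ ss) c (suc j) eq = ℕₚ.≤-trans (atᶜ-occurs ss c j eq) (ℕₚ.m≤n+m _ _)

atᶜ-unique : ∀ {K n} (ss : Vec (Colour K) n) c → occurrences (suc c) ss ≤ 1 →
  ∀ i j → atᶜ ss i ≡ suc c → atᶜ ss j ≡ suc c → i ≡ j
atᶜ-unique (s ∷ ss) c ≤1 zero    zero    p q = ≡.refl
atᶜ-unique (s ∷ ss) c ≤1 zero    (suc j) ≡.refl q rewrite does-≟-refl c =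
  contradiction (ℕₚ.≤-trans (s≤s (atᶜ-occurs ss c j q)) ≤1) λ { (s≤s ()) }
atᶜ-unique (s ∷ ss) c ≤1 (suc i) zero    p ≡.refl rewrite does-≟-refl c =
  contradiction (ℕₚ.≤-trans (s≤s (atᶜ-occurs ss c i p)) ≤1) λ { (s≤s ()) }
atᶜ-unique (s ∷ ss) c ≤1 (suc i) (suc j) p q =
  cong suc (atᶜ-unique ss c (ℕₚ.≤-trans (ℕₚ.m≤n+m _ _) ≤1) i j p q)

occurrences-absent : ∀ {K n} (c : Fin K) (as : Vec (Fin K) n) → (∀ i → Vec.lookup as i ≢ c) → occurrences c as ≡ 0
occurrences-absent c []       absent = ≡.refl
occurrences-absent c (a ∷ as) absent with a ≟ c
... | yes a≡c = contradiction a≡c (absent zero)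
... | no  _   = occurrences-absent c as (absent ∘ suc)

occurrences-injective : ∀ {K n} (c : Fin K) (as : Vec (Fin K) n) →
  (∀ {i j} → Vec.lookup as i ≡ Vec.lookup as j → i ≡ j) → occurrences c as ≤ 1
occurrences-injective c []       inj = z≤n
occurrences-injective c (a ∷ as) inj with a ≟ c
... | yes ≡.refl = s≤s (ℕₚ.≤-reflexive (occurrences-absent c as (λ i eq → contradiction (inj {suc i} {zero} eq) λ ())))
... | no  _      = occurrences-injective c as (λ eq → Finₚ.suc-injective (inj eq))

tile-conserves : ∀ {X : Set} (f : X → ℕ) t p s → f (north t p s) + f (through t p s) ≡ f p + f s
tile-conserves f t p s with isElbow t
... | true  = ≡.refl
... | false = ℕₚ.+-comm (f s) (f p)

-- Each tile permutes its two incoming colours, so no colour is created or lost in a row.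
module _ {K : ℕ} (c : Fin K) where

  private
    is : Colour K → ℕ
    is a = bit (does (a ≟ suc c))
    occ : ∀ {n} → Vec (Colour K) n → ℕ
    occ = occurrences (suc c)

  occurrences-northsʷ : ∀ {n} p (ts : Vec Tile n) ss → validʷ p ts ss ≡ true → occ (northsʷ p ts ss) ≡ is p + occ ss
  occurrences-northsʷ zero    [] [] v = ≡.refl
  occurrences-northsʷ (suc p) [] [] ()
  occurrences-northsʷ p (t ∷ ts) (s ∷ ss) v = begin
    is (north t p s) + occ (northsʷ (through t p s) ts ss)
      ≡⟨ cong (is (north t p s) +_) (occurrences-northsʷ (through t p s) ts ss (proj₂ (∧-split (fits t p s) v))) ⟩
    is (north t p s) + (is (through t p s) + occ ss)
      ≡⟨ ℕₚ.+-assoc (is (north t p s)) _ _ ⟨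
    is (north t p s) + is (through t p s) + occ ss
      ≡⟨ cong (_+ occ ss) (tile-conserves is t p s) ⟩
    is p + is s + occ ss
      ≡⟨ ℕₚ.+-assoc (is p) _ _ ⟩
    is p + (is s + occ ss) ∎
    where open ≡.≡-Reasoning

  occurrences-northsᵉ : ∀ {n} k (ts : Vec Tile n) ss → is (exitᵉ k ts ss) + occ (northsᵉ k ts ss) ≡ is k + occ ss
  occurrences-northsᵉ k [] [] = ≡.refl
  occurrences-northsᵉ k (t ∷ ts) (s ∷ ss) = begin
    is (through t q s) + (is (north t q s) + occ (northsᵉ k ts ss))
      ≡⟨ ℕₚ.+-assoc (is (through t q s)) _ _ ⟨
    is (through t q s) + is (north t q s) + occ (northsᵉ k ts ss)
      ≡⟨ cong (_+ occ (northsᵉ k ts ss)) (≡.trans (ℕₚ.+-comm (is (through t q s)) _) (≡.trans (tile-conserves is t q s) (ℕₚ.+-comm (is q) _))) ⟩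
    is s + is q + occ (northsᵉ k ts ss)
      ≡⟨ ≡.trans (ℕₚ.+-assoc (is s) _ _) (cong (is s +_) (occurrences-northsᵉ k ts ss)) ⟩
    is s + (is k + occ ss)
      ≡⟨ ≡.trans (≡.sym (ℕₚ.+-assoc (is s) _ _)) (≡.trans (cong (_+ occ ss) (ℕₚ.+-comm (is s) _)) (ℕₚ.+-assoc (is k) _ _)) ⟩
    is k + (is s + occ ss) ∎
    where
    open ≡.≡-Reasoning
    q = exitᵉ k ts ss

  occurrences-replicate : ∀ n → occ (Vec.replicate n zero) ≡ 0
  occurrences-replicate zero    = ≡.refl
  occurrences-replicate (suc n) = occurrences-replicate n

  occurrences-rowNorths : ∀ {n} h k (ts : Vec Tile n) ss → rowValid h k ts ss ≡ true →
    occ (rowNorths h k ts ss) ≡ bit (does (k ≟ c)) + occ ss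
  occurrences-rowNorths w k ts ss v = occurrences-northsʷ (suc k) ts ss v
  occurrences-rowNorths e k ts ss v
    with exitᵉ (suc k) ts ss | not-isPipe⇒zero _ (proj₂ (∧-split (fitsᵉ (suc k) ts ss) v)) | occurrences-northsᵉ (suc k) ts ss
  ... | _ | ≡.refl | eq = eq

  occurrences-norths : ∀ {m n} β ks (g : Vec (Vec Tile n) m) → valid β ks g ≡ true →
    occ (norths β ks g) ≡ occurrences c ks
  occurrences-norths {n = n} [] [] [] v = occurrences-replicate n
  occurrences-norths (h ∷ β) (k ∷ ks) (ts ∷ g) v with ∧-split (rowValid h k ts (norths β ks g)) v
  ... | v₁ , v₂ = ≡.trans (occurrences-rowNorths h k ts (norths β ks g) v₁)
    (cong (bit (does (k ≟ c)) +_) (occurrences-norths β ks g v₂))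

-- Tracing a pipe to the North boundary

module _ {K m n : ℕ} (β : Vec HT m) (ks : Vec (Fin K) m) (g : Vec (Vec Tile n) m)
         (fit : Fits β ks g) (end : Ends β ks g) where

  private
    type : ℕ → HT
    type = rowType (Vec.toList β)
    tile : ℕ → ℕ → Maybe Tile
    tile = cell (rows g)

  leaves : ∀ i j {t s c} → tile i j ≡ just t → s ≡ inSide (type i) ⊎ s ≡ S → colourAt β ks g i j s ≡ suc c →
    (connect (type i) t s ≡ just N × northAt β ks g i j ≡ suc c) ⊎
    (connect (type i) t s ≡ just (outSide (type i)) × westAt β ks g i (outPos (type i) j) ≡ suc c)
  leaves i j {t} {s} {c} eq side colour = follow-rule (exits side colour)
    where
    p = westAt β ks g i (inPos (type i) j)
    q = northAt β ks g (suc i) j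
    f : Fit t p q
    f = fits⇒Fit t p q (fit i j eq)
    exits : s ≡ inSide (type i) ⊎ s ≡ S → colourAt β ks g i j s ≡ suc c → Leaves (type i) t s (suc c) p q
    exits (inj₁ ≡.refl) col with ≡.trans (≡.sym (colourAt-in β ks g (type i) i j)) col | f
    ... | p≡ | f rewrite p≡ = leaves-in (type i) f
    exits (inj₂ ≡.refl) col with f
    ... | f rewrite col = leaves-S (type i) f
    follow-rule : Leaves (type i) t s (suc c) p q → _
    follow-rule (upward to n≡) = inj₁ (to , ≡.trans (proj₁ (grid-rule β ks g i j eq)) n≡)
    follow-rule (onward to o≡) = inj₂ (to , ≡.trans (proj₂ (grid-rule β ks g i j eq)) o≡)

  ExitsAt : Fin K → Maybe ℕ → Set
  ExitsAt c r = ∃[ j ] (r ≡ just j × northAt β ks g 0 j ≡ suc c)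

  -- The invariant is that the edge just crossed has colour `suc c`. `leaves` carries it through a
  -- tile, `Ends` excludes leaving sideways since the edge there is blank, and the fuel dominates
  -- `remaining`, which drops at each step.
  follow-exits : ∀ f i j {t s c} → tile i j ≡ just t → s ≡ inSide (type i) ⊎ s ≡ S → colourAt β ks g i j s ≡ suc c →
    remaining (type i) n i j ≤ f → ExitsAt c (follow f (Vec.toList β) (rows g) i j s)
  follow-exits zero i j eq side colour bound =
    contradiction (ℕₚ.<-≤-trans (remaining> (type i) i (proj₂ (cell-bound g i j eq))) bound) λ ()
  follow-exits (suc f) i j {t} {s} {c} eq side colour bound with leaves i j eq side colour
  follow-exits (suc f) zero j eq side colour bound | inj₁ (to , n≡) =
    j , follow-exit f (Vec.toList β) (rows g) eq to , n≡
  follow-exits (suc f) (suc i) j eq side colour bound | inj₁ (to , n≡)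
    with cell-exists g i j (ℕₚ.<-trans (ℕₚ.n<1+n i) (proj₁ (cell-bound g (suc i) j eq))) (proj₂ (cell-bound g (suc i) j eq))
  ... | t′ , eq′ rewrite follow-north f (Vec.toList β) (rows g) eq to eq′ =
    follow-exits f i j eq′ (inj₂ ≡.refl) n≡ (ℕ.s≤s⁻¹ (ℕₚ.<-≤-trans
      (ℕₚ.≤-<-trans (remaining≤ (type i) i j<n) (remaining> (type (suc i)) (suc i) j<n)) bound))
    where j<n = proj₂ (cell-bound g (suc i) j eq)
  follow-exits (suc f) i j {t} {s} {c} eq side colour bound | inj₂ (to , o≡) = onwards (type i) ≡.refl j eq to o≡ bound
    where
    onwards : ∀ h → type i ≡ h → ∀ j → tile i j ≡ just t → connect (type i) t s ≡ just (outSide (type i)) →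
      westAt β ks g i (outPos (type i) j) ≡ suc c → remaining (type i) n i j ≤ suc f →
      ExitsAt c (follow (suc f) (Vec.toList β) (rows g) i j s)
    onwards w ty j eq to o≡ bound with ℕₚ._<?_ (suc j) n
    ... | yes sj<n with cell-exists g i (suc j) (proj₁ (cell-bound g i j eq)) sj<n
    ...   | t′ , eq′ rewrite follow-east f (Vec.toList β) (rows g) eq (≡.trans to (cong (just ∘ outSide) ty)) eq′ =
      follow-exits f i (suc j) eq′ (inj₁ (≡.sym (cong inSide ty)))
        (≡.trans (cong (λ h → westAt β ks g i (outPos h j)) (≡.sym ty)) o≡)
        (≡.subst (λ h → remaining h n i (suc j) ≤ f) (≡.sym ty) (ℕ.s≤s⁻¹ (ℕₚ.<-≤-trans
          (ℕₚ.+-monoʳ-< (i * n) (ℕₚ.∸-monoʳ-< (ℕₚ.n<1+n j) (ℕₚ.<⇒≤ sj<n)))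
          (≡.subst (λ h → remaining h n i j ≤ suc f) ty bound))))
    onwards w ty j eq to o≡ bound | no sj≮n = contradiction (≡.trans (≡.sym east) o≡) λ ()
      where
      east : westAt β ks g i (outPos (type i) j) ≡ zero
      east with end i (proj₁ (cell-bound g i j eq))
      ... | eᵢ rewrite ty = ≡.trans (cong (westAt β ks g i) (ℕₚ.≤-antisym (proj₂ (cell-bound g i j eq)) (ℕₚ.≮⇒≥ sj≮n))) eᵢ
    onwards e ty zero eq to o≡ bound = contradiction (≡.trans (≡.sym west) o≡) λ ()
      where
      west : westAt β ks g i (outPos (type i) 0) ≡ zero
      west with end i (proj₁ (cell-bound g i 0 eq))
      ... | eᵢ rewrite ty = eᵢ
    onwards e ty (suc j) eq to o≡ bound
      with cell-exists g i j (proj₁ (cell-bound g i (suc j) eq)) (ℕₚ.<-trans (ℕₚ.n<1+n j) (proj₂ (cell-bound g i (suc j) eq)))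
    ... | t′ , eq′ rewrite follow-west f (Vec.toList β) (rows g) eq (≡.trans to (cong (just ∘ outSide) ty)) eq′ =
      follow-exits f i j eq′ (inj₁ (≡.sym (cong inSide ty)))
        (≡.trans (cong (λ h → westAt β ks g i (outPos h (suc j))) (≡.sym ty)) o≡)
        (≡.subst (λ h → remaining h n i j ≤ f) (≡.sym ty) (ℕ.s≤s⁻¹ (≡.subst (_≤ suc f) (ℕₚ.+-suc (i * n) (suc j))
          (≡.subst (λ h → remaining h n i (suc j) ≤ suc f) ty bound))))

  -- A pipe entering in row i visits at most (i + 1) n cells, hence at most m n, which is below the
  -- fuel.
  exitOf-exits : 1 ≤ n → ∀ i → ExitsAt (Vec.lookup ks i) (exitOf m n (Vec.toList β) (rows g) (toℕ i))
  exitOf-exits (s≤s {n = l} z≤n) i with type (toℕ i) in ty | westAt-start β ks g i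
  ... | w | start with cell-exists g (toℕ i) 0 (Finₚ.toℕ<n i) (s≤s z≤n)
  ...   | t , eq = follow-exits (4 * (m * suc l) + 4) (toℕ i) 0 eq (inj₁ (≡.sym (cong inSide ty))) start
    (fuel (remaining≤ (type (toℕ i)) (toℕ i) (proj₂ (cell-bound g (toℕ i) 0 eq))))
    where
    fuel : ∀ {r} → r ≤ suc (toℕ i) * suc l → r ≤ 4 * (m * suc l) + 4
    fuel r≤ = ℕₚ.≤-trans r≤ (ℕₚ.≤-trans (ℕₚ.*-monoˡ-≤ (suc l) (Finₚ.toℕ<n i))
      (ℕₚ.≤-trans (ℕₚ.m≤n*m (m * suc l) 4) (ℕₚ.m≤m+n _ 4)))
  exitOf-exits (s≤s {n = l} z≤n) i | e | start with cell-exists g (toℕ i) l (Finₚ.toℕ<n i) (ℕₚ.n<1+n l)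
  ...   | t , eq = follow-exits (4 * (m * suc l) + 4) (toℕ i) l eq (inj₁ (≡.sym (cong inSide ty))) start
    (fuel (remaining≤ (type (toℕ i)) (toℕ i) (proj₂ (cell-bound g (toℕ i) l eq))))
    where
    fuel : ∀ {r} → r ≤ suc (toℕ i) * suc l → r ≤ 4 * (m * suc l) + 4
    fuel r≤ = ℕₚ.≤-trans r≤ (ℕₚ.≤-trans (ℕₚ.*-monoˡ-≤ (suc l) (Finₚ.toℕ<n i))
      (ℕₚ.≤-trans (ℕₚ.m≤n*m (m * suc l) 4) (ℕₚ.m≤m+n _ 4)))

-- Connectivity read off from the top colours

label-surjective : ∀ {m} (β : Vec HT m) k → ∃[ i ] label β i ≡ k
label-surjective (w ∷ β) zero = zero , ≡.refl
label-surjective (w ∷ β) (suc k) with label-surjective β k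
... | i , eq = suc i , cong suc eq
label-surjective (e ∷ β) k with view k
... | ‵fromℕ     = zero , ≡.refl
... | ‵inject₁ k′ with label-surjective β k′
...   | i , eq = suc i , cong inject₁ eq

≡ᵇ-sound : ∀ a b → (a ≡ᵇ b) ≡ true → a ≡ b
≡ᵇ-sound zero    zero    _  = ≡.refl
≡ᵇ-sound (suc a) (suc b) eq = cong suc (≡ᵇ-sound a b eq)

≡ᵇ-refl : ∀ a → (a ≡ᵇ a) ≡ true
≡ᵇ-refl zero    = ≡.refl
≡ᵇ-refl (suc a) = ≡ᵇ-refl a

anyᵇ-tabulate⇒ : ∀ {X : Set} {k} (f : X → Bool) (g : Fin k → X) → anyᵇ f (tabulate g) ≡ true → ∃[ i ] f (g i) ≡ true
anyᵇ-tabulate⇒ {k = suc k} f g any with f (g zero) in eq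
... | true  = zero , eq
... | false with anyᵇ-tabulate⇒ f (g ∘ suc) any
...   | i , fi = suc i , fi

anyᵇ-tabulate⇐ : ∀ {X : Set} {k} (f : X → Bool) (g : Fin k → X) i → f (g i) ≡ true → anyᵇ f (tabulate g) ≡ true
anyᵇ-tabulate⇐ f g zero    fi rewrite fi = ≡.refl
anyᵇ-tabulate⇐ f g (suc i) fi with f (g zero)
... | true  = ≡.refl
... | false = anyᵇ-tabulate⇐ f (g ∘ suc) i fi

allᵇ-tabulate⇒ : ∀ {X : Set} {k} (f : X → Bool) (g : Fin k → X) → allᵇ f (tabulate g) ≡ true → ∀ i → f (g i) ≡ true
allᵇ-tabulate⇒ f g all zero    = proj₁ (∧-split (f (g zero)) all)
allᵇ-tabulate⇒ f g all (suc i) = allᵇ-tabulate⇒ f (g ∘ suc) (proj₂ (∧-split (f (g zero)) all)) i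

allᵇ-tabulate⇐ : ∀ {X : Set} {k} (f : X → Bool) (g : Fin k → X) → (∀ i → f (g i) ≡ true) → allᵇ f (tabulate g) ≡ true
allᵇ-tabulate⇐ {k = zero}  f g all = ≡.refl
allᵇ-tabulate⇐ {k = suc k} f g all = ∧-join (all zero) (allᵇ-tabulate⇐ f (g ∘ suc) (all ∘ suc))

true-iff : ∀ {a b} → (a ≡ true → b ≡ true) → (b ≡ true → a ≡ true) → a ≡ b
true-iff {true}  {b}     f g = ≡.sym (f ≡.refl)
true-iff {false} {true}  f g = g ≡.refl
true-iff {false} {false} f g = ≡.refl

module _ {m n : ℕ} (1≤n : 1 ≤ n) (π : Fin m → Fin n) (β : Vec HT m) (g : Vec (Vec Tile n) m) where

  private
    ks : Vec (Fin m) m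
    ks = labels β id
    tops : Vec (Colour m) n
    tops = norths β ks g

  validPD≡valid : validPD m n (Vec.toList β) (rows g) ≡ valid β ks g
  validPD≡valid = true-iff
    (λ v → let ok = validPD⇒ β g v in valid⇐ β ks g (sidesOK⇒Fits β ks g ok) (sidesOK⇒Ends β ks g ok 1≤n))
    (λ v → let fit , end = valid⇒ β ks g v in validPD⇐ β g (Fits⇒sidesOK β ks g fit end))

  Connects : Set
  Connects = ∀ i → exitOf m n (Vec.toList β) (rows g) (toℕ i) ≡ just (toℕ (π (label β i)))

  hasConnectivity⇒ : hasConnectivity m n (Vec.toList β) π (rows g) ≡ true → Connects
  hasConnectivity⇒ con i with anyᵇ-tabulate⇒ _ id (allᵇ-applyUpTo⇒ _ id m con (Finₚ.toℕ<n i))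
  ... | k , eq with ∧-split (φ (Vec.toList β) (toℕ i) ≡ᵇ toℕ k) eq
  ... | φ≡k , exit
    with Finₚ.toℕ-injective (≡.trans (≡.sym (φ-label β i)) (≡ᵇ-sound _ _ φ≡k))
  ... | ≡.refl = ==ᵐ-sound _ _ exit
    where
    ==ᵐ-sound : ∀ r a → (r ==ᵐ a) ≡ true → r ≡ just a
    ==ᵐ-sound (just b) a eq = cong just (≡ᵇ-sound b a eq)

  hasConnectivity⇐ : Connects → hasConnectivity m n (Vec.toList β) π (rows g) ≡ true
  hasConnectivity⇐ con = allᵇ-applyUpTo⇐ _ id m λ {i} i<m → anyᵇ-tabulate⇐ _ id (label β (fromℕ< i<m))
    (≡.subst (λ i′ → (φ (Vec.toList β) i′ ≡ᵇ toℕ (label β (fromℕ< i<m)))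
        ∧ (exitOf m n (Vec.toList β) (rows g) i′ ==ᵐ toℕ (π (label β (fromℕ< i<m)))) ≡ true)
      (Finₚ.toℕ-fromℕ< i<m) (at-row (fromℕ< i<m)))
    where
    at-row : ∀ i → (φ (Vec.toList β) (toℕ i) ≡ᵇ toℕ (label β i))
      ∧ (exitOf m n (Vec.toList β) (rows g) (toℕ i) ==ᵐ toℕ (π (label β i))) ≡ true
    at-row i rewrite con i | φ-label β i = ∧-join (≡ᵇ-refl (toℕ (label β i))) (≡ᵇ-refl (toℕ (π (label β i))))

  module _ (v : valid β ks g ≡ true) where

    exits : ∀ i → ∃[ j ] (exitOf m n (Vec.toList β) (rows g) (toℕ i) ≡ just j × atᶜ tops j ≡ suc (label β i))
    exits i with valid⇒ β ks g v
    ... | fit , end with exitOf-exits β ks g fit end 1≤n i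
    ... | j , exit , top = j , exit ,
      ≡.trans (≡.sym (northAt-top β ks g j)) (≡.trans top (cong suc (lookup-labels β id i)))

    -- By conservation a colour occurs on the top line as often as among the labels, and the labels
    -- are distinct.
    top-unique : ∀ c i j → atᶜ tops i ≡ suc c → atᶜ tops j ≡ suc c → i ≡ j
    top-unique c = atᶜ-unique tops c (≡.subst (_≤ 1) (≡.sym (occurrences-norths c β ks g v))
      (occurrences-injective c ks (λ {i} {j} eq →
        label-injective β (≡.trans (≡.sym (lookup-labels β id i)) (≡.trans eq (lookup-labels β id j))))))

    -- Every pipe number is the label of some row, so the statement about rows covers all columns
    -- `π k`.
    connects⇒reads : Connects → reads π tops ≡ true
    connects⇒reads con = allᵇ-tabulate⇐ _ id λ k → dec-true (_ ≟ _) (top k)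
      where
      top : ∀ k → Vec.lookup tops (π k) ≡ suc k
      top k with label-surjective β k
      ... | i , ≡.refl with exits i
      ... | j , exit , at-j with ≡.trans (≡.sym exit) (con i)
      ... | ≡.refl = ≡.trans (≡.sym (atᶜ-lookup tops (π (label β i)))) at-j

    -- Tracing ends in some column of the right colour, and `reads` places that colour in the
    -- prescribed column; uniqueness identifies the two.
    reads⇒connects : reads π tops ≡ true → Connects
    reads⇒connects r i with exits i
    ... | j , exit , at-j = ≡.trans exit (cong just (top-unique (label β i) j _ at-j
      (≡.trans (atᶜ-lookup tops (π (label β i))) (does-≟⇒≡ _ _ (allᵇ-tabulate⇒ _ id r (label β i))))))

  -- The two connectivity tests are compared only on valid grids, where tracing is known to follow
  -- the colours; elsewhere both conjunctions are false.
  isPipeDream≡ : (validPD m n (Vec.toList β) (rows g) ∧ hasConnectivity m n (Vec.toList β) π (rows g))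
    ≡ (valid β ks g ∧ reads π tops)
  isPipeDream≡ rewrite validPD≡valid with valid β ks g in v
  ... | false = ≡.refl
  ... | true  = true-iff (connects⇒reads v ∘ hasConnectivity⇒) (hasConnectivity⇐ ∘ reads⇒connects v)

theorem3p6 : (m n : ℕ) → 1 ≤ m → m ≤ n →
    (π : Fin m → Fin n) → Injective _≡_ _≡_ π →
    (β β′ : Vec HT m) →
    ∀ {c ℓ : Level} (R : CommutativeRing c ℓ) →
    (x y : ℕ → CommutativeRing.Carrier R) (A B : CommutativeRing.Carrier R) →
    CommutativeRing._≈_ R (G R m n β π x y A B) (G R m n β′ π x y A B)
theorem3p6 m n 1≤m m≤n π _ β β′ R x y A B = trans (G-allW π spec β) (sym (G-allW π spec β′))
  where
  open CommutativeRing R using (trans; sym)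
  open GridSum R x y A B {m} {n}
  spec = isPipeDream≡ (ℕₚ.≤-trans 1≤m m≤n) π
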